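{- $c(D,M)=c_{5/6}(D,M)=1/36$, where $D$ is the diamond graph and $M$ is the moth graph.
   Context: The diamond graph $D$ is $K_4$ minus one edge. The moth graph $M$ is obtained from two vertex-disjoint triangles by adding one edge joining a vertex of one triangle to a vertex of the other. For graphs $H,G$, $t(H,G)=\hom(H,G)/v(G)^{v(H)}$ is the probability that a uniformly random map $V(H)\to V(G)$ is a homomorphism. Let $G_1,G_2,\dots$ be a sequence containing every finite graph exactly once; $\overline{G}$ is the complement of $G$. For $\lambda\in[0,2]$, $c_\lambda(H_1,H_2):=\liminf_{n\to\infty}\left[\lambda\, t(H_1,G_n)+(2-\lambda)\, t(H_2,\overline{G_n})\right]$, and $c(H_1,H_2):=\sup_{\lambda\in[0,2]}c_\lambda(H_1,H_2)$.
   Formalization: The parameter λ in the supremum defining c(D,M) ranges over the rational numbers in [0,2] instead of all real numbers in [0,2]. -}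

module Defs where

open import Data.Bool using (Bool; true; false; not; _∧_; T)
open import Data.Bool.Properties using (T?)
open import Data.Nat as ℕ using (ℕ; zero; suc; _^_)
open import Data.Nat.Properties using (m^n≢0)
open import Data.Fin as Fin using (Fin; #_)
open import Data.List using (List; []; _∷_; map; concatMap; filter; length; allFin)
open import Data.Bool.ListAction using (all)
open import Data.Product using (_×_; _,_; proj₁; proj₂)
open import Data.Integer using (+_)
open import Data.Rational as ℚ using (ℚ; 0ℚ; _+_; _-_; _*_; _≤_; _<_)
open import Relation.Binary.PropositionalEquality using (_≡_)
open import Relation.Nullary.Decidable using (⌊_⌋)

record Graph : Set where
  field
    size : ℕ
    adj  : Fin size → Fin size → Bool
    sym  : ∀ x y → adj x y ≡ adj y x
    irr  : ∀ x → adj x x ≡ false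
open Graph public

coAdj : (G : Graph) → Fin (size G) → Fin (size G) → Bool
coAdj G x y = not (adj G x y) ∧ not ⌊ x Fin.≟ y ⌋

record Pattern : Set where
  field
    order : ℕ
    edges : List (Fin order × Fin order)
open Pattern public

allMaps : (k n : ℕ) → List (Fin k → Fin n)
allMaps zero    n = (λ ()) ∷ []
allMaps (suc k) n =
  concatMap (λ f → map (λ v → extend v f) (allFin n)) (allMaps k n)
  where
  extend : Fin n → (Fin k → Fin n) → Fin (suc k) → Fin n
  extend v f Fin.zero    = v
  extend v f (Fin.suc i) = f i

isHom : (H : Pattern) {n : ℕ} (a : Fin n → Fin n → Bool) → (Fin (order H) → Fin n) → Bool
isHom H a f = all (λ e → a (f (proj₁ e)) (f (proj₂ e))) (edges H)

hom : (H : Pattern) {n : ℕ} (a : Fin n → Fin n → Bool) → ℕ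
hom H {n} a = length (filter (λ f → T? (isHom H a f)) (allMaps (order H) n))

-- Homomorphism density t(H, ·) = hom / n^{v(H)}  (set to 0 on the empty graph,
-- which never matters below since only large graphs are considered).
tDens : (H : Pattern) {n : ℕ} (a : Fin n → Fin n → Bool) → ℚ
tDens H {zero}  a = 0ℚ
tDens H {suc m} a = ℚ._/_ (+ hom H a) (suc m ^ order H) {{m^n≢0 (suc m) (order H)}}

t : Pattern → Graph → ℚ
t H G = tDens H (adj G)

tCo : Pattern → Graph → ℚ
tCo H G = tDens H (coAdj G)

-- Diamond D = K4 minus the edge {2,3}.
diamond : Pattern
diamond = record { order = 4
                 ; edges = (# 0 , # 1) ∷ (# 0 , # 2) ∷ (# 0 , # 3) ∷ (# 1 , # 2) ∷ (# 1 , # 3) ∷ [] }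

-- Moth M = triangles {0,1,2} and {3,4,5} plus the edge {2,3}.
moth : Pattern
moth = record { order = 6
              ; edges = (# 0 , # 1) ∷ (# 0 , # 2) ∷ (# 1 , # 2)
                      ∷ (# 3 , # 4) ∷ (# 3 , # 5) ∷ (# 4 , # 5)
                      ∷ (# 2 , # 3) ∷ [] }

val : Pattern → Pattern → ℚ → Graph → ℚ
val H₁ H₂ λ' G = λ' * t H₁ G + (ℚ._/_ (+ 2) 1 - λ') * tCo H₂ G

-- liminf over an enumeration of all finite graphs.  Since there are only
-- finitely many graphs of each order, "n → ∞ in the enumeration" is the same
-- as "v(G) → ∞".
-- c_λ(H1,H2) ≥ L :  ∀ ε > 0, eventually (v(G) ≥ N) the value is ≥ L - ε.
LiminfGE : Pattern → Pattern → ℚ → ℚ → Set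
LiminfGE H₁ H₂ λ' L =
  ∀ (ε : ℚ) → 0ℚ < ε → Σ ℕ (λ N → ∀ (G : Graph) → N ℕ.≤ size G → L - ε ≤ val H₁ H₂ λ' G)
  where open import Data.Product using (Σ)

LiminfLE : Pattern → Pattern → ℚ → ℚ → Set
LiminfLE H₁ H₂ λ' L =
  ∀ (ε : ℚ) → 0ℚ < ε → ∀ (N : ℕ) → Σ Graph (λ G → N ℕ.≤ size G × val H₁ H₂ λ' G ≤ L + ε)
  where open import Data.Product using (Σ)

LiminfEq : Pattern → Pattern → ℚ → ℚ → Set
LiminfEq H₁ H₂ λ' L = LiminfGE H₁ H₂ λ' L × LiminfLE H₁ H₂ λ' L

{-# OPTIONS --safe #-}

module Submission where

open import Defs hiding (sym)
open import Data.Bool using (Bool; true; false; not; _∧_; if_then_else_; T)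
open import Data.Bool.ListAction using (and)
import Data.Bool.Properties as Bool
open import Data.Bool.Properties using (T?; T-∧; T-≡)
open import Data.Empty using (⊥-elim)
open import Data.Fin using (Fin; zero; suc; #_; _≟_; _↑ˡ_; _↑ʳ_; combine; quotient; remainder)
import Data.Fin.Properties as Fin
open import Data.Integer using (ℤ; +_; -[1+_]; 0ℤ; 1ℤ; _+_; _*_; _-_; -_)
import Data.Integer as ℤ
import Data.Integer.Properties as ℤ
open import Data.Integer.Tactic.RingSolver using (solve-∀)
open import Data.List as List using (List; []; _∷_; concatMap; allFin; filter; length; _++_)
import Data.List.Properties as List
open import Data.List.Relation.Unary.All using (All; []; _∷_)
open import Data.Nat as ℕ using (ℕ; zero; suc; _^_; _!)
import Data.Nat.Properties as ℕ
open import Data.Product using (_×_; _,_; proj₁; proj₂; uncurry)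
open import Data.Rational as ℚ using (ℚ; 0ℚ; mkℚ; *≤*; toℚᵘ; ↥_; ↧ₙ_; _/_; _≤_)
open import Data.Rational.Literals using (fromℤ)
import Data.Rational.Properties as ℚ
open import Data.Rational.Solver using (module +-*-Solver)
open import Data.Rational.Unnormalised as ℚᵘ using (mkℚᵘ; *≡*)
import Data.Rational.Unnormalised.Properties as ℚᵘ
open import Data.Unit using (tt)
open import Data.Vec as Vec using (Vec; []; _∷_; map; zipWith; head; tail; take; drop; lookup)
import Data.Vec.Properties as Vec
open import Function using (_∘_; _$_; _on_; Equivalence)
open import Relation.Binary.PropositionalEquality
  using (_≡_; _≢_; _≗_; refl; sym; trans; cong; cong₂; subst; subst₂; module ≡-Reasoning)
open import Relation.Nullary using (yes; no)
open import Relation.Nullary.Decidable using (⌊_⌋; from-yes)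
open import Algebra.Properties.Semiring.Sum ℤ.+-*-semiring
  using (sum; sum-cong-≗; ∑-distrib-+; ∑-comm; *-distribˡ-sum)

-- The extremal graph is the tensor product K₃ × K₄, blown up: its diamond density and the
-- moth density of its complement are both 1/72, so it gives 1/36 for every λ at once.
--
-- For the lower bound let A be a symmetric irreflexive 0/1 kernel and B = 1 - A.  By a
-- flag algebra argument, 30 t(D, A) + 42 t(M, B) ≥ 1.  Write the left side minus the right
-- side as an average over six-tuples of vertices and subtract a nonnegative average of
-- quadratic forms in flag densities rooted at an edge, at a non-edge and at an induced P₄.
-- The remaining function of a six-tuple is nonnegative on every six-vertex graph once it is
-- summed over the orderings of the six vertices.  The complement of a graph on n vertices
-- differs from B only on the diagonal, which costs at most 7 n⁵ moths.

-- The weights 30 and 42 are 36 times 5/6 and 36 times 7/6. The inequality is tight on K₃ × K₄, so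
-- every quadratic form has to vanish there. The flag tables are built for this: for each choice of
-- the roots in K₃ × K₄ the flag vectors sum to zero. In the coordinates that remain the matrices
-- are strictly positive definite, which integer elimination certifies by positive pivots alone.
--
-- All six vertices are drawn independently and with repetition. Averages of products over the same
-- roots therefore factor exactly, and no error term appears until the loops of B are removed.
--
-- The obstacle is the size of the finite check: 2¹⁵ adjacency patterns with 720 orderings each. A
-- sum over orderings does not change when the tuple is reordered, so each tuple may be sorted by a
-- degree invariant beforehand, and only patterns whose invariants already descend have to be
-- evaluated.

private variable
  A B V W : Set
  k m n : ℕ

-- Sums over tuples and over permutations of a tuple

sum-nonneg : (f : Fin n → ℤ) → (∀ x → 0ℤ ℤ.≤ f x) → 0ℤ ℤ.≤ sum f
sum-nonneg {zero}  f f≥0 = ℤ.≤-refl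
sum-nonneg {suc n} f f≥0 = ℤ.+-mono-≤ (f≥0 zero) (sum-nonneg (f ∘ suc) (f≥0 ∘ suc))


total : ∀ k → (Vec (Fin n) k → ℤ) → ℤ
total zero    φ = φ []
total (suc k) φ = sum λ x → total k (φ ∘ (x ∷_))

total-cong : ∀ k {φ ψ : Vec (Fin n) k → ℤ} → φ ≗ ψ → total k φ ≡ total k ψ
total-cong zero    φ≗ψ = φ≗ψ []
total-cong (suc k) φ≗ψ = sum-cong-≗ λ x → total-cong k (φ≗ψ ∘ (x ∷_))

total-+ : ∀ k (φ ψ : Vec (Fin n) k → ℤ) → total k (λ v → φ v + ψ v) ≡ total k φ + total k ψ
total-+ zero    φ ψ = refl
total-+ (suc k) φ ψ = trans
  (sum-cong-≗ λ x → total-+ k (φ ∘ (x ∷_)) (ψ ∘ (x ∷_)))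
  (∑-distrib-+ (λ x → total k (φ ∘ (x ∷_))) (λ x → total k (ψ ∘ (x ∷_))))

total-*ˡ : ∀ k c (φ : Vec (Fin n) k → ℤ) → total k (λ v → c * φ v) ≡ c * total k φ
total-*ˡ zero    c φ = refl
total-*ˡ (suc k) c φ = trans
  (sum-cong-≗ λ x → total-*ˡ k c (φ ∘ (x ∷_)))
  (sym (*-distribˡ-sum c (λ x → total k (φ ∘ (x ∷_)))))

total-*ʳ : ∀ k c (φ : Vec (Fin n) k → ℤ) → total k (λ v → φ v * c) ≡ total k φ * c
total-*ʳ k c φ = trans (total-cong k λ v → ℤ.*-comm (φ v) c)
  (trans (total-*ˡ k c φ) (ℤ.*-comm c (total k φ)))

total-nonneg : ∀ k {φ : Vec (Fin n) k → ℤ} → (∀ v → 0ℤ ℤ.≤ φ v) → 0ℤ ℤ.≤ total k φ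
total-nonneg zero    φ≥0 = φ≥0 []
total-nonneg (suc k) φ≥0 = sum-nonneg _ λ x → total-nonneg k (φ≥0 ∘ (x ∷_))

total-product : ∀ j k (φ : Vec (Fin n) j → ℤ) (ψ : Vec (Fin n) k → ℤ) →
  total j (λ v → total k (λ w → φ v * ψ w)) ≡ total j φ * total k ψ
total-product j k φ ψ = trans (total-cong j λ v → total-*ˡ k (φ v) ψ) (total-*ʳ j (total k ψ) φ)

insertSum : (Vec V (suc k) → ℤ) → V → Vec V k → ℤ
insertSum φ x []       = φ (x ∷ [])
insertSum φ x (y ∷ ys) = φ (x ∷ y ∷ ys) + insertSum (φ ∘ (y ∷_)) x ys

-- The orderings are never listed: the head is absorbed into the summed function, which then also
-- runs over the places where the head can be inserted.
permSum : (Vec V k → ℤ) → Vec V k → ℤ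
permSum φ []       = φ []
permSum φ (x ∷ xs) = permSum (insertSum φ x) xs

insertSum-cong : {φ ψ : Vec V (suc k) → ℤ} → φ ≗ ψ → ∀ x → insertSum φ x ≗ insertSum ψ x
insertSum-cong φ≗ψ x []       = φ≗ψ (x ∷ [])
insertSum-cong φ≗ψ x (y ∷ ys) =
  cong₂ _+_ (φ≗ψ (x ∷ y ∷ ys)) (insertSum-cong (φ≗ψ ∘ (y ∷_)) x ys)

permSum-cong : {φ ψ : Vec V k → ℤ} → φ ≗ ψ → permSum φ ≗ permSum ψ
permSum-cong φ≗ψ []       = φ≗ψ []
permSum-cong φ≗ψ (x ∷ xs) = permSum-cong (insertSum-cong φ≗ψ x) xs

insertSum-+ : (φ ψ : Vec V (suc k) → ℤ) → ∀ x v →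
  insertSum (λ w → φ w + ψ w) x v ≡ insertSum φ x v + insertSum ψ x v
insertSum-+ φ ψ x []       = refl
insertSum-+ φ ψ x (y ∷ ys) = trans
  (cong (_+_ (φ (x ∷ y ∷ ys) + ψ (x ∷ y ∷ ys))) (insertSum-+ (φ ∘ (y ∷_)) (ψ ∘ (y ∷_)) x ys))
  (interchange (φ (x ∷ y ∷ ys)) (ψ (x ∷ y ∷ ys)) _ _)
  where
  interchange : ∀ a b c d → (a + b) + (c + d) ≡ (a + c) + (b + d)
  interchange = solve-∀

insertSum-map : (f : V → W) (φ : Vec W (suc k) → ℤ) → ∀ x v →
  insertSum φ (f x) (map f v) ≡ insertSum (φ ∘ map f) x v
insertSum-map f φ x []       = refl
insertSum-map f φ x (y ∷ ys) =
  cong (_+_ (φ (f x ∷ f y ∷ map f ys))) (insertSum-map f (φ ∘ (f y ∷_)) x ys)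

permSum-map : (f : V → W) (φ : Vec W k → ℤ) → ∀ v → permSum φ (map f v) ≡ permSum (φ ∘ map f) v
permSum-map f φ []       = refl
permSum-map f φ (x ∷ xs) = trans
  (permSum-map f (insertSum φ (f x)) xs)
  (permSum-cong (insertSum-map f φ x) xs)

-- Two successive insertions reach the same tuples in either order. The invariance of `permSum`
-- under reordering rests on this.
insertSum-comm : (φ : Vec V (suc (suc k)) → ℤ) → ∀ x y v →
  insertSum (insertSum φ x) y v ≡ insertSum (insertSum φ y) x v
insertSum-comm φ x y []       = ℤ.+-comm (φ (x ∷ y ∷ [])) (φ (y ∷ x ∷ []))
insertSum-comm φ x y (z ∷ zs) = begin
  insertSum φ x (y ∷ z ∷ zs) + insertSum (insertSum φ x ∘ (z ∷_)) y zs
    ≡⟨ cong (_+_ (insertSum φ x (y ∷ z ∷ zs)))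
         (insertSum-+ (φ ∘ (x ∷_) ∘ (z ∷_)) (insertSum (φ ∘ (z ∷_)) x) y zs) ⟩
  (φ (x ∷ y ∷ z ∷ zs) + (φ (y ∷ x ∷ z ∷ zs) + X)) + (Y + insertSum (insertSum (φ ∘ (z ∷_)) x) y zs)
    ≡⟨ cong (λ s → (φ (x ∷ y ∷ z ∷ zs) + (φ (y ∷ x ∷ z ∷ zs) + X)) + (Y + s))
         (insertSum-comm (φ ∘ (z ∷_)) x y zs) ⟩
  (φ (x ∷ y ∷ z ∷ zs) + (φ (y ∷ x ∷ z ∷ zs) + X)) + (Y + insertSum (insertSum (φ ∘ (z ∷_)) y) x zs)
    ≡⟨ rearrange (φ (x ∷ y ∷ z ∷ zs)) (φ (y ∷ x ∷ z ∷ zs)) X Y _ ⟩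
  (φ (y ∷ x ∷ z ∷ zs) + (φ (x ∷ y ∷ z ∷ zs) + Y)) + (X + insertSum (insertSum (φ ∘ (z ∷_)) y) x zs)
    ≡⟨ cong (_+_ (insertSum φ y (x ∷ z ∷ zs)))
         (insertSum-+ (φ ∘ (y ∷_) ∘ (z ∷_)) (insertSum (φ ∘ (z ∷_)) y) x zs) ⟨
  insertSum φ y (x ∷ z ∷ zs) + insertSum (insertSum φ y ∘ (z ∷_)) x zs ∎
  where
  open ≡-Reasoning
  X Y : ℤ
  X = insertSum (φ ∘ (y ∷_) ∘ (z ∷_)) x zs
  Y = insertSum (φ ∘ (x ∷_) ∘ (z ∷_)) y zs
  rearrange : ∀ a b c d e → (a + (b + c)) + (d + e) ≡ (b + (a + d)) + (c + e)
  rearrange = solve-∀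

-- Each of the `suc k` positions of x contributes a full sum over tuples, because the order of
-- summation can be exchanged.
total-insertSum : ∀ k (φ : Vec (Fin n) (suc k) → ℤ) →
  (sum λ x → total k (insertSum φ x)) ≡ + suc k * total (suc k) φ
total-insertSum zero    φ = sym (ℤ.*-identityˡ _)
total-insertSum (suc k) φ = begin
  (sum λ x → sum λ y → total k (λ ys → φ (x ∷ y ∷ ys) + insertSum (φ ∘ (y ∷_)) x ys))
    ≡⟨ (sum-cong-≗ λ x → total-+ (suc k) (φ ∘ (x ∷_)) (later x)) ⟩
  (sum λ x → total (suc k) (φ ∘ (x ∷_)) + total (suc k) (later x))
    ≡⟨ ∑-distrib-+ (λ x → total (suc k) (φ ∘ (x ∷_))) (λ x → total (suc k) (later x)) ⟩
  total (suc (suc k)) φ + (sum λ x → sum λ y → total k (insertSum (φ ∘ (y ∷_)) x))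
    ≡⟨ cong (_+_ (total (suc (suc k)) φ)) (∑-comm λ x y → total k (insertSum (φ ∘ (y ∷_)) x)) ⟩
  total (suc (suc k)) φ + (sum λ y → sum λ x → total k (insertSum (φ ∘ (y ∷_)) x))
    ≡⟨ cong (_+_ (total (suc (suc k)) φ)) (sum-cong-≗ λ y → total-insertSum k (φ ∘ (y ∷_))) ⟩
  total (suc (suc k)) φ + (sum λ y → + suc k * total (suc k) (φ ∘ (y ∷_)))
    ≡⟨ cong (_+_ (total (suc (suc k)) φ)) (*-distribˡ-sum (+ suc k) (λ y → total (suc k) (φ ∘ (y ∷_)))) ⟨
  total (suc (suc k)) φ + + suc k * total (suc (suc k)) φ
    ≡⟨ ℤ.suc-* (+ suc k) (total (suc (suc k)) φ) ⟨
  + suc (suc k) * total (suc (suc k)) φ ∎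
  where
  open ≡-Reasoning
  later : Fin _ → Vec (Fin _) (suc k) → ℤ
  later x (y ∷ ys) = insertSum (φ ∘ (y ∷_)) x ys

total-permSum : ∀ k (φ : Vec (Fin n) k → ℤ) → total k (permSum φ) ≡ + (k !) * total k φ
total-permSum zero    φ = sym (ℤ.*-identityˡ _)
total-permSum (suc k) φ = begin
  (sum λ x → total k (permSum (insertSum φ x)))
    ≡⟨ (sum-cong-≗ λ x → total-permSum k (insertSum φ x)) ⟩
  (sum λ x → + (k !) * total k (insertSum φ x))
    ≡⟨ *-distribˡ-sum (+ (k !)) (λ x → total k (insertSum φ x)) ⟨
  + (k !) * (sum λ x → total k (insertSum φ x))
    ≡⟨ cong (+ (k !) *_) (total-insertSum k φ) ⟩
  + (k !) * (+ suc k * total (suc k) φ)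
    ≡⟨ ℤ.*-assoc (+ (k !)) (+ suc k) _ ⟨
  + (k !) * + suc k * total (suc k) φ
    ≡⟨ cong (_* total (suc k) φ) (trans (sym (ℤ.pos-* (k !) (suc k))) (cong +_ (ℕ.*-comm (k !) (suc k)))) ⟩
  + (suc k !) * total (suc k) φ ∎
  where open ≡-Reasoning

-- A full sum does not see the order of the entries, so negative values of φ are allowed as long as
-- the other orderings of the same tuple compensate for them.
total-nonneg-by-symmetry : ∀ k (φ : Vec (Fin n) k → ℤ) → (∀ v → 0ℤ ℤ.≤ permSum φ v) → 0ℤ ℤ.≤ total k φ
total-nonneg-by-symmetry k φ ≥0 =
  ℤ.*-cancelˡ-≤-pos 0ℤ (total k φ) (+ (k !)) {{ℤ.positive (ℤ.+<+ (ℕ.1≤n! k))}} $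
    subst (ℤ._≤ + (k !) * total k φ) (sym (ℤ.*-zeroʳ (+ (k !)))) $
    subst (0ℤ ℤ.≤_) (total-permSum k φ) (total-nonneg k ≥0)

-- Sorting a tuple by a key, and statistics that sorting preserves

descending : Vec ℕ k → Bool
descending []           = true
descending (_ ∷ [])     = true
descending (a ∷ b ∷ as) = (b ℕ.≤ᵇ a) ∧ descending (b ∷ as)

module _ (key : V → ℕ) where

  insert : V → Vec V k → Vec V (suc k)
  insert x []       = x ∷ []
  insert x (y ∷ ys) = if key y ℕ.≤ᵇ key x then x ∷ y ∷ ys else y ∷ insert x ys

  sort : Vec V k → Vec V k
  sort []       = []
  sort (x ∷ xs) = insert x (sort xs)

  permSum-insert : (φ : Vec V (suc k) → ℤ) → ∀ x v → permSum φ (insert x v) ≡ permSum φ (x ∷ v)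
  permSum-insert φ x []       = refl
  permSum-insert φ x (y ∷ ys) with key y ℕ.≤ᵇ key x
  ... | true  = refl
  ... | false = trans (permSum-insert (insertSum φ y) x ys) (permSum-cong (insertSum-comm φ y x) ys)

  permSum-sort : (φ : Vec V k → ℤ) → ∀ v → permSum φ (sort v) ≡ permSum φ v
  permSum-sort φ []       = refl
  permSum-sort φ (x ∷ xs) = trans (permSum-insert φ x (sort xs)) (permSum-sort (insertSum φ x) xs)

  insert-descending : ∀ x (v : Vec V k) → T (descending (map key v)) → T (descending (map key (insert x v)))
  insert-descending x []       _ = tt
  insert-descending x (y ∷ ys) d with key y ℕ.≤ᵇ key x in eq
  ... | true  rewrite eq = d
  ... | false = prepend y ys (≰ᵇ⇒≥ᵇ eq) d
    where
    ≰ᵇ⇒≥ᵇ : ∀ {y} → (key y ℕ.≤ᵇ key x) ≡ false → T (key x ℕ.≤ᵇ key y)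
    ≰ᵇ⇒≥ᵇ {y} eq = ℕ.≤⇒≤ᵇ {key x} {key y} (ℕ.<⇒≤ (ℕ.≰⇒> λ le → subst T eq (ℕ.≤⇒≤ᵇ {key y} {key x} le)))
    prepend : ∀ {k} y (ys : Vec V k) → T (key x ℕ.≤ᵇ key y) → T (descending (map key (y ∷ ys))) →
      T (descending (map key (y ∷ insert x ys)))
    prepend y []       x≤y _ = Equivalence.from T-∧ (x≤y , tt)
    prepend y (z ∷ zs) x≤y d with key z ℕ.≤ᵇ key x in eq | Equivalence.to T-∧ d
    ... | true  | _   , d′ rewrite eq = Equivalence.from T-∧ (x≤y , d′)
    ... | false | z≤y , d′ = Equivalence.from T-∧ (z≤y , prepend z zs (≰ᵇ⇒≥ᵇ eq) d′)

  sort-descending : (v : Vec V k) → T (descending (map key (sort v)))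
  sort-descending []       = tt
  sort-descending (x ∷ xs) = insert-descending x (sort xs) (sort-descending xs)

tally : (V → ℕ) → Vec V k → ℕ
tally f []       = 0
tally f (x ∷ xs) = f x ℕ.+ tally f xs

tally-cong : {f g : V → ℕ} → f ≗ g → (v : Vec V k) → tally f v ≡ tally g v
tally-cong f≗g []       = refl
tally-cong f≗g (x ∷ xs) = cong₂ ℕ._+_ (f≗g x) (tally-cong f≗g xs)

tally-map : (f : V → ℕ) (h : W → V) (v : Vec W k) → tally f (map h v) ≡ tally (f ∘ h) v
tally-map f h []       = refl
tally-map f h (x ∷ xs) = cong (f (h x) ℕ.+_) (tally-map f h xs)

tally-insert : (key f : V → ℕ) → ∀ x (v : Vec V k) → tally f (insert key x v) ≡ f x ℕ.+ tally f v
tally-insert key f x []       = refl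
tally-insert key f x (y ∷ ys) with key y ℕ.≤ᵇ key x
... | true  = refl
... | false = trans (cong (f y ℕ.+_) (tally-insert key f x ys)) (x+[y+z]≡y+[x+z] (f y) (f x) _)
  where
  x+[y+z]≡y+[x+z] : ∀ a b c → a ℕ.+ (b ℕ.+ c) ≡ b ℕ.+ (a ℕ.+ c)
  x+[y+z]≡y+[x+z] a b c = trans (sym (ℕ.+-assoc a b c)) (trans (cong (ℕ._+ c) (ℕ.+-comm a b)) (ℕ.+-assoc b a c))

tally-sort : (key f : V → ℕ) (v : Vec V k) → tally f (sort key v) ≡ tally f v
tally-sort key f []       = refl
tally-sort key f (x ∷ xs) = trans (tally-insert key f x (sort key xs)) (cong (f x ℕ.+_) (tally-sort key f xs))

-- Positive definite forms and tables indexed by bits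

dot : Vec ℤ n → Vec ℤ n → ℤ
dot []       []       = 0ℤ
dot (x ∷ xs) (y ∷ ys) = x * y + dot xs ys

-- Symmetric matrices, stored as the rows of their upper triangles.
data Symmetric : ℕ → Set where
  []  : Symmetric 0
  _∷_ : Vec ℤ (suc n) → Symmetric n → Symmetric (suc n)

-- The bilinear rather than the quadratic form: its two arguments come from two independent groups
-- of free vertices over the same roots.
form : Symmetric n → Vec ℤ n → Vec ℤ n → ℤ
form []            []       []       = 0ℤ
form ((a ∷ q) ∷ M) (x ∷ xs) (y ∷ ys) = a * (x * y) + (x * dot q ys + y * dot q xs) + form M xs ys

-- The Schur complement of the pivot `a`, multiplied by `a` so that it stays integral.
schur : ℤ → Vec ℤ n → Symmetric n → Symmetric n
schur a []       []             = []
schur a (q ∷ qs) ((m ∷ ms) ∷ M) =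
  ((a * m - q * q) ∷ zipWith (λ q′ m′ → a * m′ - q * q′) qs ms) ∷ schur a qs M

positive? : ℤ → Bool
positive? (+ suc _) = true
positive? _         = false

positiveDefinite : Symmetric n → Bool
positiveDefinite []            = true
positiveDefinite ((a ∷ q) ∷ M) = positive? a ∧ positiveDefinite (schur a q M)

dot-schur : ∀ a c (q m y : Vec ℤ n) →
  dot (zipWith (λ q′ m′ → a * m′ - c * q′) q m) y ≡ a * dot m y - c * dot q y
dot-schur a c []       []       []       = lemma a c
  where
  lemma : ∀ a c → 0ℤ ≡ a * 0ℤ - c * 0ℤ
  lemma = solve-∀
dot-schur a c (q ∷ qs) (m ∷ ms) (y ∷ ys) =
  trans (cong (_+_ ((a * m - c * q) * y)) (dot-schur a c qs ms ys)) (lemma a c q m y _ _)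
  where
  lemma : ∀ a c q m y s t → (a * m - c * q) * y + (a * s - c * t) ≡ a * (m * y + s) - c * (q * y + t)
  lemma = solve-∀

form-schur : ∀ a q (M : Symmetric n) xs ys →
  form (schur a q M) xs ys ≡ a * form M xs ys - dot q xs * dot q ys
form-schur a []       []             []       []       = lemma a
  where
  lemma : ∀ a → 0ℤ ≡ a * 0ℤ - 0ℤ * 0ℤ
  lemma = solve-∀
form-schur a (q ∷ qs) ((m ∷ ms) ∷ M) (x ∷ xs) (y ∷ ys)
  rewrite dot-schur a q qs ms xs | dot-schur a q qs ms ys | form-schur a qs M xs ys =
  lemma a q m x y (dot ms xs) (dot ms ys) (dot qs xs) (dot qs ys) (form M xs ys)
  where
  lemma : ∀ a q m x y mx my qx qy f →
    (a * m - q * q) * (x * y) + (x * (a * my - q * qy) + y * (a * mx - q * qx)) + (a * f - qx * qy)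
    ≡ a * (m * (x * y) + (x * my + y * mx) + f) - (q * x + qx) * (q * y + qy)
  lemma = solve-∀

complete-square : ∀ a q (M : Symmetric n) x xs y ys →
  a * form ((a ∷ q) ∷ M) (x ∷ xs) (y ∷ ys)
  ≡ (a * x + dot q xs) * (a * y + dot q ys) + form (schur a q M) xs ys
complete-square a q M x xs y ys rewrite form-schur a q M xs ys =
  lemma a x y (dot q xs) (dot q ys) (form M xs ys)
  where
  lemma : ∀ a x y qx qy f →
    a * (a * (x * y) + (x * qy + y * qx) + f) ≡ (a * x + qx) * (a * y + qy) + (a * f - qx * qy)
  lemma = solve-∀

square-nonneg : ∀ x → 0ℤ ℤ.≤ x * x
square-nonneg (+ x)    = subst (0ℤ ℤ.≤_) (ℤ.pos-* x x) (ℤ.+≤+ ℕ.z≤n)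
square-nonneg -[1+ x ] = ℤ.+≤+ ℕ.z≤n

-- Completing the square splits off `L v * L w`, whose double sum is the square of `total k L`. What
-- remains is the form of the Schur complement on the tails, and the positive pivot cancels in the
-- end.
total-form-nonneg : (M : Symmetric m) → T (positiveDefinite M) → (F : Vec (Fin n) k → Vec ℤ m) →
  0ℤ ℤ.≤ total k (λ v → total k (λ w → form M (F v) (F w)))
total-form-nonneg {k = k} [] _ F =
  total-nonneg k λ v → total-nonneg k λ w → ℤ.≤-reflexive (sym (empty (F v) (F w)))
  where
  empty : ∀ x y → form [] x y ≡ 0ℤ
  empty [] [] = refl
total-form-nonneg {k = k} ((+ suc a ∷ q) ∷ M) pd F =
  ℤ.*-cancelˡ-≤-pos 0ℤ _ (+ suc a) $ subst (ℤ._≤ + suc a * S) (sym (ℤ.*-zeroʳ (+ suc a))) $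
    subst (0ℤ ℤ.≤_) (sym split) $
    ℤ.+-mono-≤ (square-nonneg (total k L)) (total-form-nonneg (schur (+ suc a) q M) pd (tail ∘ F))
  where
  open ≡-Reasoning
  N = (+ suc a ∷ q) ∷ M
  S = total k (λ v → total k (λ w → form N (F v) (F w)))
  L : Vec _ k → ℤ
  L v = + suc a * head (F v) + dot q (tail (F v))
  R : Vec _ k → Vec _ k → ℤ
  R v w = form (schur (+ suc a) q M) (tail (F v)) (tail (F w))
  pointwise : ∀ x y → + suc a * form N x y ≡
    (+ suc a * head x + dot q (tail x)) * (+ suc a * head y + dot q (tail y))
    + form (schur (+ suc a) q M) (tail x) (tail y)
  pointwise (x ∷ xs) (y ∷ ys) = complete-square (+ suc a) q M x xs y ys
  split : + suc a * S ≡ total k L * total k L + total k (λ v → total k (R v))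
  split = begin
    + suc a * S
      ≡⟨ total-*ˡ k (+ suc a) _ ⟨
    total k (λ v → + suc a * total k (λ w → form N (F v) (F w)))
      ≡⟨ (total-cong k λ v → trans (sym (total-*ˡ k (+ suc a) (λ w → form N (F v) (F w))))
           (trans (total-cong k λ w → pointwise (F v) (F w)) (total-+ k (λ w → L v * L w) (R v)))) ⟩
    total k (λ v → total k (λ w → L v * L w) + total k (R v))
      ≡⟨ total-+ k (λ v → total k (λ w → L v * L w)) (λ v → total k (R v)) ⟩
    total k (λ v → total k (λ w → L v * L w)) + total k (λ v → total k (R v))
      ≡⟨ cong (ℤ._+ total k (λ v → total k (R v))) (total-product k k L L) ⟩
    total k L * total k L + total k (λ v → total k (R v)) ∎

data Table (A : Set) : ℕ → Set where
  leaf : A → Table A 0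
  node : Table A n → Table A n → Table A (suc n)

look : {A : Set} → Table A n → Vec Bool n → A
look (leaf x)   []          = x
look (node l r) (false ∷ b) = look l b
look (node l r) (true  ∷ b) = look r b

tabulate : {A : Set} → ∀ n → (Vec Bool n → A) → Table A n
tabulate zero    f = leaf (f [])
tabulate (suc n) f = node (tabulate n (f ∘ (false ∷_))) (tabulate n (f ∘ (true ∷_)))

look-tabulate : {A : Set} (f : Vec Bool n → A) → look (tabulate n f) ≗ f
look-tabulate f []          = refl
look-tabulate f (false ∷ b) = look-tabulate (f ∘ (false ∷_)) b
look-tabulate f (true  ∷ b) = look-tabulate (f ∘ (true ∷_)) b

everyBits : ∀ n → (Vec Bool n → Bool) → Bool
everyBits zero    p = p []
everyBits (suc n) p = everyBits n (p ∘ (false ∷_)) ∧ everyBits n (p ∘ (true ∷_))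

everyBits-sound : ∀ n (p : Vec Bool n → Bool) → everyBits n p ≡ true → ∀ b → p b ≡ true
everyBits-sound zero    p t []          = t
everyBits-sound (suc n) p t (false ∷ b) = everyBits-sound n (p ∘ (false ∷_)) (∧-injectiveˡ t) b
  where
  ∧-injectiveˡ : ∀ {c d} → c ∧ d ≡ true → c ≡ true
  ∧-injectiveˡ {true} _ = refl
everyBits-sound (suc n) p t (true  ∷ b) = everyBits-sound n (p ∘ (true ∷_)) (∧-injectiveʳ _ t) b
  where
  ∧-injectiveʳ : ∀ c {d} → c ∧ d ≡ true → d ≡ true
  ∧-injectiveʳ true t = t

-- The certificate

fromVec : {A : Set} → ∀ n → Vec A (2 ^ n) → Table A n
fromVec zero    (x ∷ []) = leaf x
fromVec (suc n) xs       =
  node (fromVec n (take (2 ^ n) xs)) (fromVec n (take (2 ^ n) (drop (2 ^ n) xs)))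

-- The coefficients come from rounding a numerical solution of the flag algebra semidefinite
-- program; the matrices are multiplied by scale.  With roots x, y and free vertices u, v, row
-- number i of a table is the flag whose adjacencies x u, y u, x v, y v, u v are the binary
-- digits of i, most significant first.  In the path tables the roots x, y, u, v induce the
-- path v x y u, and the digits are the adjacencies of one free vertex to x, y, u, v.  Even and
-- odd refer to the reversal of the roots.
module Certificate where
  open import Agda.Builtin.FromNat using (fromNat)
  open import Agda.Builtin.FromNeg using (fromNeg)
  import Data.Nat.Literals as ℕ
  import Data.Integer.Literals as Literals

  private instance
    _ = ℕ.number
    _ = Literals.number
    _ = Literals.negative

  scale : ℤ
  scale = 248832

  -- Flags that differ by exchanging x with y or u with v share a row. Over an edge of K₃ × K₄ each
  -- of the first two flags occurs for two pairs (u, v); their rows are fitted so that every column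
  -- sums to zero over all pairs.
  edgeFlags : Table (Vec ℤ 12) 5
  edgeFlags = fromVec 5
    (  (-4 ∷ -4 ∷ 0 ∷ -2 ∷ -6 ∷ -2 ∷ -2 ∷ -6 ∷ -4 ∷ -4 ∷ -1 ∷ 0 ∷ [])
    ∷  (-6 ∷ -2 ∷ 0 ∷ -2 ∷ -6 ∷ -2 ∷ -1 ∷ -7 ∷ -4 ∷ -4 ∷ -1 ∷ 0 ∷ [])
    ∷  (1 ∷ 0 ∷ 0 ∷ 0 ∷ 0 ∷ 0 ∷ 0 ∷ 0 ∷ 0 ∷ 0 ∷ 0 ∷ 0 ∷ [])
    ∷  (0 ∷ 1 ∷ 0 ∷ 0 ∷ 0 ∷ 0 ∷ 0 ∷ 0 ∷ 0 ∷ 0 ∷ 0 ∷ 0 ∷ [])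
    ∷  (1 ∷ 0 ∷ 0 ∷ 0 ∷ 0 ∷ 0 ∷ 0 ∷ 0 ∷ 0 ∷ 0 ∷ 0 ∷ 0 ∷ [])
    ∷  (0 ∷ 1 ∷ 0 ∷ 0 ∷ 0 ∷ 0 ∷ 0 ∷ 0 ∷ 0 ∷ 0 ∷ 0 ∷ 0 ∷ [])
    ∷  (0 ∷ 0 ∷ 1 ∷ 0 ∷ 0 ∷ 0 ∷ 0 ∷ 0 ∷ 0 ∷ 0 ∷ 0 ∷ 0 ∷ [])
    ∷  (0 ∷ 0 ∷ 0 ∷ 1 ∷ 0 ∷ 0 ∷ 0 ∷ 0 ∷ 0 ∷ 0 ∷ 0 ∷ 0 ∷ [])
    ∷  (1 ∷ 0 ∷ 0 ∷ 0 ∷ 0 ∷ 0 ∷ 0 ∷ 0 ∷ 0 ∷ 0 ∷ 0 ∷ 0 ∷ [])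
    ∷  (0 ∷ 1 ∷ 0 ∷ 0 ∷ 0 ∷ 0 ∷ 0 ∷ 0 ∷ 0 ∷ 0 ∷ 0 ∷ 0 ∷ [])
    ∷  (0 ∷ 0 ∷ 0 ∷ 0 ∷ 1 ∷ 0 ∷ 0 ∷ 0 ∷ 0 ∷ 0 ∷ 0 ∷ 0 ∷ [])
    ∷  (0 ∷ 0 ∷ 0 ∷ 0 ∷ 0 ∷ 1 ∷ 0 ∷ 0 ∷ 0 ∷ 0 ∷ 0 ∷ 0 ∷ [])
    ∷  (0 ∷ 0 ∷ 0 ∷ 0 ∷ 0 ∷ 0 ∷ 1 ∷ 0 ∷ 0 ∷ 0 ∷ 0 ∷ 0 ∷ [])
    ∷  (0 ∷ 0 ∷ 0 ∷ 0 ∷ 0 ∷ 0 ∷ 0 ∷ 1 ∷ 0 ∷ 0 ∷ 0 ∷ 0 ∷ [])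
    ∷  (0 ∷ 0 ∷ 0 ∷ 0 ∷ 0 ∷ 0 ∷ 0 ∷ 0 ∷ 1 ∷ 0 ∷ 0 ∷ 0 ∷ [])
    ∷  (0 ∷ 0 ∷ 0 ∷ 0 ∷ 0 ∷ 0 ∷ 0 ∷ 0 ∷ 0 ∷ 1 ∷ 0 ∷ 0 ∷ [])
    ∷  (1 ∷ 0 ∷ 0 ∷ 0 ∷ 0 ∷ 0 ∷ 0 ∷ 0 ∷ 0 ∷ 0 ∷ 0 ∷ 0 ∷ [])
    ∷  (0 ∷ 1 ∷ 0 ∷ 0 ∷ 0 ∷ 0 ∷ 0 ∷ 0 ∷ 0 ∷ 0 ∷ 0 ∷ 0 ∷ [])
    ∷  (0 ∷ 0 ∷ 0 ∷ 0 ∷ 0 ∷ 0 ∷ 1 ∷ 0 ∷ 0 ∷ 0 ∷ 0 ∷ 0 ∷ [])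
    ∷  (0 ∷ 0 ∷ 0 ∷ 0 ∷ 0 ∷ 0 ∷ 0 ∷ 1 ∷ 0 ∷ 0 ∷ 0 ∷ 0 ∷ [])
    ∷  (0 ∷ 0 ∷ 0 ∷ 0 ∷ 1 ∷ 0 ∷ 0 ∷ 0 ∷ 0 ∷ 0 ∷ 0 ∷ 0 ∷ [])
    ∷  (0 ∷ 0 ∷ 0 ∷ 0 ∷ 0 ∷ 1 ∷ 0 ∷ 0 ∷ 0 ∷ 0 ∷ 0 ∷ 0 ∷ [])
    ∷  (0 ∷ 0 ∷ 0 ∷ 0 ∷ 0 ∷ 0 ∷ 0 ∷ 0 ∷ 1 ∷ 0 ∷ 0 ∷ 0 ∷ [])
    ∷  (0 ∷ 0 ∷ 0 ∷ 0 ∷ 0 ∷ 0 ∷ 0 ∷ 0 ∷ 0 ∷ 1 ∷ 0 ∷ 0 ∷ [])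
    ∷  (0 ∷ 0 ∷ 1 ∷ 0 ∷ 0 ∷ 0 ∷ 0 ∷ 0 ∷ 0 ∷ 0 ∷ 0 ∷ 0 ∷ [])
    ∷  (0 ∷ 0 ∷ 0 ∷ 1 ∷ 0 ∷ 0 ∷ 0 ∷ 0 ∷ 0 ∷ 0 ∷ 0 ∷ 0 ∷ [])
    ∷  (0 ∷ 0 ∷ 0 ∷ 0 ∷ 0 ∷ 0 ∷ 0 ∷ 0 ∷ 1 ∷ 0 ∷ 0 ∷ 0 ∷ [])
    ∷  (0 ∷ 0 ∷ 0 ∷ 0 ∷ 0 ∷ 0 ∷ 0 ∷ 0 ∷ 0 ∷ 1 ∷ 0 ∷ 0 ∷ [])
    ∷  (0 ∷ 0 ∷ 0 ∷ 0 ∷ 0 ∷ 0 ∷ 0 ∷ 0 ∷ 1 ∷ 0 ∷ 0 ∷ 0 ∷ [])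
    ∷  (0 ∷ 0 ∷ 0 ∷ 0 ∷ 0 ∷ 0 ∷ 0 ∷ 0 ∷ 0 ∷ 1 ∷ 0 ∷ 0 ∷ [])
    ∷  (0 ∷ 0 ∷ 0 ∷ 0 ∷ 0 ∷ 0 ∷ 0 ∷ 0 ∷ 0 ∷ 0 ∷ 1 ∷ 0 ∷ [])
    ∷  (0 ∷ 0 ∷ 0 ∷ 0 ∷ 0 ∷ 0 ∷ 0 ∷ 0 ∷ 0 ∷ 0 ∷ 0 ∷ 1 ∷ [])
    ∷ [])

  edgeMatrix : Symmetric 12
  edgeMatrix =
       (2369088 ∷ -1078272 ∷ 777600 ∷ -1218240 ∷ 1425600 ∷ -1358208 ∷ 590976 ∷ -1070352 ∷ 228096 ∷ -1980288 ∷ -632448 ∷ -3162240 ∷ [])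
    ∷  (2571264 ∷ -2156544 ∷ 1052352 ∷ -1228608 ∷ 2715552 ∷ -2006208 ∷ 1254528 ∷ -2452032 ∷ 854424 ∷ -2016576 ∷ 1435968 ∷ [])
    ∷  (5878656 ∷ 1923264 ∷ -1492992 ∷ -3623616 ∷ 4510080 ∷ 1607040 ∷ 1010880 ∷ 440640 ∷ -3571776 ∷ -2659392 ∷ [])
    ∷  (4152384 ∷ -4199040 ∷ -917568 ∷ 2597184 ∷ 4116096 ∷ -2260224 ∷ 2607552 ∷ -6977664 ∷ 938304 ∷ [])
    ∷  (5448384 ∷ 580608 ∷ -3706560 ∷ -5057856 ∷ 2787912 ∷ -3354048 ∷ 8164800 ∷ -1539648 ∷ [])
    ∷  (5370624 ∷ -4841856 ∷ -689472 ∷ -1938384 ∷ 326592 ∷ 2353536 ∷ 2270592 ∷ [])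
    ∷  (8180352 ∷ 3338496 ∷ 383616 ∷ 1435968 ∷ -6676992 ∷ -1425600 ∷ [])
    ∷  (4883328 ∷ -2928960 ∷ 2908224 ∷ -8449920 ∷ 855360 ∷ [])
    ∷  (3825792 ∷ -1202688 ∷ 6236352 ∷ -103680 ∷ [])
    ∷  (2830464 ∷ -3141504 ∷ 2638656 ∷ [])
    ∷  (18423936 ∷ 2348352 ∷ [])
    ∷  (6371136 ∷ [])
    ∷ []

  -- The blow-up of K₃ × K₄ has three kinds of non-edges: twins, pairs that agree only in the first
  -- coordinate and pairs that agree only in the second. Each kind imposes a linear condition on
  -- every column.
  coEdgeEvenFlags : Table (Vec ℤ 10) 5
  coEdgeEvenFlags = fromVec 5
    (  (0 ∷ -4 ∷ 2 ∷ 0 ∷ 4 ∷ 8 ∷ -4 ∷ 4 ∷ -2 ∷ -4 ∷ [])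
    ∷  (-4 ∷ 0 ∷ -4 ∷ 0 ∷ -8 ∷ -16 ∷ 8 ∷ -8 ∷ -8 ∷ 2 ∷ [])
    ∷  (1 ∷ -1 ∷ 1 ∷ 0 ∷ 4 ∷ 2 ∷ -4 ∷ 1 ∷ 1 ∷ -1 ∷ [])
    ∷  (-1 ∷ 1 ∷ -2 ∷ 0 ∷ -5 ∷ -7 ∷ 2 ∷ -5 ∷ -2 ∷ 2 ∷ [])
    ∷  (1 ∷ -1 ∷ 1 ∷ 0 ∷ 4 ∷ 2 ∷ -4 ∷ 1 ∷ 1 ∷ -1 ∷ [])
    ∷  (-1 ∷ 1 ∷ -2 ∷ 0 ∷ -5 ∷ -7 ∷ 2 ∷ -5 ∷ -2 ∷ 2 ∷ [])
    ∷  (2 ∷ 0 ∷ 0 ∷ 0 ∷ 0 ∷ 0 ∷ 0 ∷ 0 ∷ 0 ∷ 0 ∷ [])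
    ∷  (0 ∷ 2 ∷ 0 ∷ 0 ∷ 0 ∷ 0 ∷ 0 ∷ 0 ∷ 0 ∷ 0 ∷ [])
    ∷  (1 ∷ -1 ∷ 1 ∷ 0 ∷ 4 ∷ 2 ∷ -4 ∷ 1 ∷ 1 ∷ -1 ∷ [])
    ∷  (-1 ∷ 1 ∷ -2 ∷ 0 ∷ -5 ∷ -7 ∷ 2 ∷ -5 ∷ -2 ∷ 2 ∷ [])
    ∷  (0 ∷ 0 ∷ 1 ∷ 0 ∷ 0 ∷ 0 ∷ 0 ∷ 0 ∷ 0 ∷ 0 ∷ [])
    ∷  (0 ∷ 0 ∷ 0 ∷ 1 ∷ 0 ∷ 0 ∷ 0 ∷ 0 ∷ 0 ∷ 0 ∷ [])
    ∷  (0 ∷ 0 ∷ 0 ∷ 0 ∷ 6 ∷ 0 ∷ 0 ∷ 0 ∷ 0 ∷ 0 ∷ [])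
    ∷  (0 ∷ 0 ∷ 0 ∷ 0 ∷ 0 ∷ 6 ∷ 0 ∷ 0 ∷ 0 ∷ 0 ∷ [])
    ∷  (0 ∷ 0 ∷ 0 ∷ 0 ∷ 0 ∷ 0 ∷ 3 ∷ 0 ∷ 0 ∷ 0 ∷ [])
    ∷  (0 ∷ 0 ∷ 0 ∷ 0 ∷ 0 ∷ 0 ∷ 0 ∷ 3 ∷ 0 ∷ 0 ∷ [])
    ∷  (1 ∷ -1 ∷ 1 ∷ 0 ∷ 4 ∷ 2 ∷ -4 ∷ 1 ∷ 1 ∷ -1 ∷ [])
    ∷  (-1 ∷ 1 ∷ -2 ∷ 0 ∷ -5 ∷ -7 ∷ 2 ∷ -5 ∷ -2 ∷ 2 ∷ [])
    ∷  (0 ∷ 0 ∷ 0 ∷ 0 ∷ 6 ∷ 0 ∷ 0 ∷ 0 ∷ 0 ∷ 0 ∷ [])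
    ∷  (0 ∷ 0 ∷ 0 ∷ 0 ∷ 0 ∷ 6 ∷ 0 ∷ 0 ∷ 0 ∷ 0 ∷ [])
    ∷  (0 ∷ 0 ∷ 1 ∷ 0 ∷ 0 ∷ 0 ∷ 0 ∷ 0 ∷ 0 ∷ 0 ∷ [])
    ∷  (0 ∷ 0 ∷ 0 ∷ 1 ∷ 0 ∷ 0 ∷ 0 ∷ 0 ∷ 0 ∷ 0 ∷ [])
    ∷  (0 ∷ 0 ∷ 0 ∷ 0 ∷ 0 ∷ 0 ∷ 3 ∷ 0 ∷ 0 ∷ 0 ∷ [])
    ∷  (0 ∷ 0 ∷ 0 ∷ 0 ∷ 0 ∷ 0 ∷ 0 ∷ 3 ∷ 0 ∷ 0 ∷ [])
    ∷  (2 ∷ 0 ∷ 0 ∷ 0 ∷ 0 ∷ 0 ∷ 0 ∷ 0 ∷ 0 ∷ 0 ∷ [])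
    ∷  (0 ∷ 2 ∷ 0 ∷ 0 ∷ 0 ∷ 0 ∷ 0 ∷ 0 ∷ 0 ∷ 0 ∷ [])
    ∷  (0 ∷ 0 ∷ 0 ∷ 0 ∷ 0 ∷ 0 ∷ 3 ∷ 0 ∷ 0 ∷ 0 ∷ [])
    ∷  (0 ∷ 0 ∷ 0 ∷ 0 ∷ 0 ∷ 0 ∷ 0 ∷ 3 ∷ 0 ∷ 0 ∷ [])
    ∷  (0 ∷ 0 ∷ 0 ∷ 0 ∷ 0 ∷ 0 ∷ 3 ∷ 0 ∷ 0 ∷ 0 ∷ [])
    ∷  (0 ∷ 0 ∷ 0 ∷ 0 ∷ 0 ∷ 0 ∷ 0 ∷ 3 ∷ 0 ∷ 0 ∷ [])
    ∷  (0 ∷ 0 ∷ 0 ∷ 0 ∷ 0 ∷ 0 ∷ 0 ∷ 0 ∷ 6 ∷ 0 ∷ [])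
    ∷  (0 ∷ 0 ∷ 0 ∷ 0 ∷ 0 ∷ 0 ∷ 0 ∷ 0 ∷ 0 ∷ 6 ∷ [])
    ∷ [])

  coEdgeEvenMatrix : Symmetric 10
  coEdgeEvenMatrix =
       (758916 ∷ -7059 ∷ 1467072 ∷ -274752 ∷ 46656 ∷ -248449 ∷ 236262 ∷ -11450 ∷ -74844 ∷ -41455 ∷ [])
    ∷  (1410048 ∷ -1062720 ∷ 1088640 ∷ -165282 ∷ 206760 ∷ -695178 ∷ 370044 ∷ -685800 ∷ 102132 ∷ [])
    ∷  (6350400 ∷ 181440 ∷ -171192 ∷ -1059288 ∷ 907200 ∷ -357696 ∷ 248832 ∷ -278628 ∷ [])
    ∷  (5012928 ∷ -730944 ∷ -222912 ∷ -767232 ∷ 699840 ∷ -368064 ∷ 336960 ∷ [])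
    ∷  (146940 ∷ 33670 ∷ 175922 ∷ -52852 ∷ 101424 ∷ -1840 ∷ [])
    ∷  (211476 ∷ -185928 ∷ 1588 ∷ -81120 ∷ 6230 ∷ [])
    ∷  (559872 ∷ -133028 ∷ 391752 ∷ 1326 ∷ [])
    ∷  (275664 ∷ -148464 ∷ 121176 ∷ [])
    ∷  (430272 ∷ 21552 ∷ [])
    ∷  (95328 ∷ [])
    ∷ []

  -- Exchanging x and y negates a row. Some automorphism of the blow-up exchanges the two ends of
  -- any given non-edge, so these vectors sum to zero there by symmetry.
  coEdgeOddFlags : Table (Vec ℤ 6) 5
  coEdgeOddFlags = fromVec 5
    (  (0 ∷ 0 ∷ 0 ∷ 0 ∷ 0 ∷ 0 ∷ [])
    ∷  (0 ∷ 0 ∷ 0 ∷ 0 ∷ 0 ∷ 0 ∷ [])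
    ∷  (1 ∷ 0 ∷ 0 ∷ 0 ∷ 0 ∷ 0 ∷ [])
    ∷  (0 ∷ 1 ∷ 0 ∷ 0 ∷ 0 ∷ 0 ∷ [])
    ∷  (-1 ∷ 0 ∷ 0 ∷ 0 ∷ 0 ∷ 0 ∷ [])
    ∷  (0 ∷ -1 ∷ 0 ∷ 0 ∷ 0 ∷ 0 ∷ [])
    ∷  (0 ∷ 0 ∷ 0 ∷ 0 ∷ 0 ∷ 0 ∷ [])
    ∷  (0 ∷ 0 ∷ 0 ∷ 0 ∷ 0 ∷ 0 ∷ [])
    ∷  (1 ∷ 0 ∷ 0 ∷ 0 ∷ 0 ∷ 0 ∷ [])
    ∷  (0 ∷ 1 ∷ 0 ∷ 0 ∷ 0 ∷ 0 ∷ [])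
    ∷  (0 ∷ 0 ∷ 1 ∷ 0 ∷ 0 ∷ 0 ∷ [])
    ∷  (0 ∷ 0 ∷ 0 ∷ 1 ∷ 0 ∷ 0 ∷ [])
    ∷  (0 ∷ 0 ∷ 0 ∷ 0 ∷ 0 ∷ 0 ∷ [])
    ∷  (0 ∷ 0 ∷ 0 ∷ 0 ∷ 0 ∷ 0 ∷ [])
    ∷  (0 ∷ 0 ∷ 0 ∷ 0 ∷ 1 ∷ 0 ∷ [])
    ∷  (0 ∷ 0 ∷ 0 ∷ 0 ∷ 0 ∷ 1 ∷ [])
    ∷  (-1 ∷ 0 ∷ 0 ∷ 0 ∷ 0 ∷ 0 ∷ [])
    ∷  (0 ∷ -1 ∷ 0 ∷ 0 ∷ 0 ∷ 0 ∷ [])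
    ∷  (0 ∷ 0 ∷ 0 ∷ 0 ∷ 0 ∷ 0 ∷ [])
    ∷  (0 ∷ 0 ∷ 0 ∷ 0 ∷ 0 ∷ 0 ∷ [])
    ∷  (0 ∷ 0 ∷ -1 ∷ 0 ∷ 0 ∷ 0 ∷ [])
    ∷  (0 ∷ 0 ∷ 0 ∷ -1 ∷ 0 ∷ 0 ∷ [])
    ∷  (0 ∷ 0 ∷ 0 ∷ 0 ∷ -1 ∷ 0 ∷ [])
    ∷  (0 ∷ 0 ∷ 0 ∷ 0 ∷ 0 ∷ -1 ∷ [])
    ∷  (0 ∷ 0 ∷ 0 ∷ 0 ∷ 0 ∷ 0 ∷ [])
    ∷  (0 ∷ 0 ∷ 0 ∷ 0 ∷ 0 ∷ 0 ∷ [])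
    ∷  (0 ∷ 0 ∷ 0 ∷ 0 ∷ 1 ∷ 0 ∷ [])
    ∷  (0 ∷ 0 ∷ 0 ∷ 0 ∷ 0 ∷ 1 ∷ [])
    ∷  (0 ∷ 0 ∷ 0 ∷ 0 ∷ -1 ∷ 0 ∷ [])
    ∷  (0 ∷ 0 ∷ 0 ∷ 0 ∷ 0 ∷ -1 ∷ [])
    ∷  (0 ∷ 0 ∷ 0 ∷ 0 ∷ 0 ∷ 0 ∷ [])
    ∷  (0 ∷ 0 ∷ 0 ∷ 0 ∷ 0 ∷ 0 ∷ [])
    ∷ [])

  coEdgeOddMatrix : Symmetric 6
  coEdgeOddMatrix =
       (1513728 ∷ 601344 ∷ 1298484 ∷ -1529280 ∷ 54342 ∷ -575424 ∷ [])
    ∷  (1679616 ∷ -2699712 ∷ -2068416 ∷ -2009286 ∷ -1880568 ∷ [])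
    ∷  (9528192 ∷ 3338496 ∷ 4525632 ∷ 3748032 ∷ [])
    ∷  (6153408 ∷ 2861568 ∷ 4292352 ∷ [])
    ∷  (5111424 ∷ 4722624 ∷ [])
    ∷  (6397056 ∷ [])
    ∷ []

  pathEvenFlags : Table (Vec ℤ 6) 4
  pathEvenFlags = fromVec 4
    (  (-4 ∷ 0 ∷ 0 ∷ 0 ∷ 0 ∷ -2 ∷ [])
    ∷  (-2 ∷ 0 ∷ 0 ∷ 1 ∷ 0 ∷ -1 ∷ [])
    ∷  (-2 ∷ 0 ∷ 0 ∷ 1 ∷ 0 ∷ -1 ∷ [])
    ∷  (0 ∷ 0 ∷ 0 ∷ 2 ∷ 0 ∷ 0 ∷ [])
    ∷  (-1 ∷ 0 ∷ 0 ∷ -1 ∷ 0 ∷ -1 ∷ [])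
    ∷  (1 ∷ 0 ∷ 0 ∷ 0 ∷ 0 ∷ 0 ∷ [])
    ∷  (0 ∷ 1 ∷ 0 ∷ 0 ∷ 0 ∷ 0 ∷ [])
    ∷  (0 ∷ 0 ∷ 0 ∷ 0 ∷ 1 ∷ 0 ∷ [])
    ∷  (-1 ∷ 0 ∷ 0 ∷ -1 ∷ 0 ∷ -1 ∷ [])
    ∷  (0 ∷ 1 ∷ 0 ∷ 0 ∷ 0 ∷ 0 ∷ [])
    ∷  (1 ∷ 0 ∷ 0 ∷ 0 ∷ 0 ∷ 0 ∷ [])
    ∷  (0 ∷ 0 ∷ 0 ∷ 0 ∷ 1 ∷ 0 ∷ [])
    ∷  (2 ∷ 0 ∷ 0 ∷ 0 ∷ -2 ∷ 2 ∷ [])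
    ∷  (0 ∷ 0 ∷ 1 ∷ 0 ∷ 0 ∷ 0 ∷ [])
    ∷  (0 ∷ 0 ∷ 1 ∷ 0 ∷ 0 ∷ 0 ∷ [])
    ∷  (0 ∷ 0 ∷ 0 ∷ 0 ∷ 0 ∷ 2 ∷ [])
    ∷ [])

  pathEvenMatrix : Symmetric 6
  pathEvenMatrix =
       (414720 ∷ -181440 ∷ -715392 ∷ 31104 ∷ -550944 ∷ -938304 ∷ [])
    ∷  (1684800 ∷ 689472 ∷ -331776 ∷ 829440 ∷ 1425600 ∷ [])
    ∷  (3198528 ∷ -907200 ∷ 917568 ∷ 2509056 ∷ [])
    ∷  (1197504 ∷ 1021248 ∷ -207360 ∷ [])
    ∷  (3359232 ∷ 2726784 ∷ [])
    ∷  (3841344 ∷ [])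
    ∷ []

  pathOddFlags : Table (Vec ℤ 5) 4
  pathOddFlags = fromVec 4
    (  (0 ∷ 0 ∷ 0 ∷ 0 ∷ 0 ∷ [])
    ∷  (-1 ∷ 0 ∷ 0 ∷ 0 ∷ 0 ∷ [])
    ∷  (1 ∷ 0 ∷ 0 ∷ 0 ∷ 0 ∷ [])
    ∷  (0 ∷ 0 ∷ 0 ∷ 0 ∷ 0 ∷ [])
    ∷  (1 ∷ -1 ∷ 0 ∷ 0 ∷ 0 ∷ [])
    ∷  (0 ∷ -1 ∷ 0 ∷ 0 ∷ 0 ∷ [])
    ∷  (0 ∷ 0 ∷ 1 ∷ 0 ∷ 0 ∷ [])
    ∷  (0 ∷ 0 ∷ 0 ∷ 0 ∷ -1 ∷ [])
    ∷  (-1 ∷ 1 ∷ 0 ∷ 0 ∷ 0 ∷ [])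
    ∷  (0 ∷ 0 ∷ -1 ∷ 0 ∷ 0 ∷ [])
    ∷  (0 ∷ 1 ∷ 0 ∷ 0 ∷ 0 ∷ [])
    ∷  (0 ∷ 0 ∷ 0 ∷ 0 ∷ 1 ∷ [])
    ∷  (0 ∷ 0 ∷ 0 ∷ 0 ∷ 0 ∷ [])
    ∷  (0 ∷ 0 ∷ 0 ∷ -1 ∷ 0 ∷ [])
    ∷  (0 ∷ 0 ∷ 0 ∷ 1 ∷ 0 ∷ [])
    ∷  (0 ∷ 0 ∷ 0 ∷ 0 ∷ 0 ∷ [])
    ∷ [])

  pathOddMatrix : Symmetric 5
  pathOddMatrix =
       (6272640 ∷ 3070656 ∷ 9460800 ∷ 5567616 ∷ -1675296 ∷ [])
    ∷  (12623040 ∷ -5697216 ∷ 3872448 ∷ 9543744 ∷ [])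
    ∷  (31731264 ∷ 11845440 ∷ -17117568 ∷ [])
    ∷  (11352960 ∷ -4867776 ∷ [])
    ∷  (16905024 ∷ [])
    ∷ []



open Certificate

-- With the values of the form tabulated, a square inside the finite check is a lookup.
formTable : Table (Vec ℤ m) k → Symmetric m → Table (Table ℤ k) k
formTable {k = k} F M = tabulate k λ p → tabulate k λ q → form M (look F p) (look F q)

addTable : Table (Table ℤ k) k → Table (Table ℤ k) k → Table (Table ℤ k) k
addTable {k = k} s t = tabulate k λ p → tabulate k λ q → look (look s p) q + look (look t p) q

indicator : Bool → ℤ
indicator true  = 1ℤ
indicator false = 0ℤ

-- The bits are the adjacencies within a tuple (x, y, u, v, w, z); the diamond lies on x, y, u, v
-- and misses x y, the moth has triangles x y u and v w z joined by u v.
core : Vec Bool 15 → ℤ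
core (xy ∷ xu ∷ xv ∷ xw ∷ xz ∷ yu ∷ yv ∷ yw ∷ yz ∷ uv ∷ uw ∷ uz ∷ vw ∷ vz ∷ wz ∷ []) =
  + 30 * indicator (uv ∧ yv ∧ xv ∧ yu ∧ xu ∧ true)
  + + 42 * indicator (not wz ∧ not vz ∧ not vw ∧ not yu ∧ not xu ∧ not xy ∧ not uv ∧ true)
  + - 1ℤ

module _ (E C : Table (Table ℤ 5) 5) (P : Table (Table ℤ 4) 4) where
  -- Two roots with twice two free vertices and four roots with twice one free vertex both use six
  -- vertices, so one six-tuple carries both kinds of products. In the path case u and v become
  -- roots, and w and z are the two free vertices.
  squares : Vec Bool 15 → ℤ
  squares (xy ∷ xu ∷ xv ∷ xw ∷ xz ∷ yu ∷ yv ∷ yw ∷ yz ∷ uv ∷ uw ∷ uz ∷ vw ∷ vz ∷ wz ∷ []) =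
    look (look (if xy then E else C) (xu ∷ yu ∷ xv ∷ yv ∷ uv ∷ [])) (xw ∷ yw ∷ xz ∷ yz ∷ wz ∷ [])
    + (if xy ∧ xv ∧ yu ∧ not xu ∧ not yv ∧ not uv
       then look (look P (xw ∷ yw ∷ uw ∷ vw ∷ [])) (xz ∷ yz ∷ uz ∷ vz ∷ []) else 0ℤ)

edgeTable coEdgeTable : Table (Table ℤ 5) 5
edgeTable   = formTable edgeFlags edgeMatrix
coEdgeTable = addTable (formTable coEdgeEvenFlags coEdgeEvenMatrix) (formTable coEdgeOddFlags coEdgeOddMatrix)

pathTable : Table (Table ℤ 4) 4
pathTable = addTable (formTable pathEvenFlags pathEvenMatrix) (formTable pathOddFlags pathOddMatrix)

-- Graphs on six vertices and the finite check

pairs : Vec V 6 → Vec (V × V) 15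
pairs (x ∷ y ∷ u ∷ v ∷ w ∷ z ∷ []) =
  (x , y) ∷ (x , u) ∷ (x , v) ∷ (x , w) ∷ (x , z) ∷ (y , u) ∷ (y , v) ∷ (y , w) ∷ (y , z)
  ∷ (u , v) ∷ (u , w) ∷ (u , z) ∷ (v , w) ∷ (v , z) ∷ (w , z) ∷ []

bits : (V → V → Bool) → Vec V 6 → Vec Bool 15
bits g v = map (uncurry g) (pairs v)

data Six : Set where
  s₀ s₁ s₂ s₃ s₄ s₅ : Six

six : Vec Six 6
six = s₀ ∷ s₁ ∷ s₂ ∷ s₃ ∷ s₄ ∷ s₅ ∷ []

graph : Vec Bool 15 → Six → Six → Bool
graph (a ∷ b ∷ c ∷ d ∷ e ∷ f ∷ g ∷ h ∷ i ∷ j ∷ k ∷ l ∷ m ∷ n ∷ o ∷ []) = λ where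
  s₀ s₀ → false ; s₀ s₁ → a ; s₀ s₂ → b ; s₀ s₃ → c ; s₀ s₄ → d ; s₀ s₅ → e
  s₁ s₀ → a ; s₁ s₁ → false ; s₁ s₂ → f ; s₁ s₃ → g ; s₁ s₄ → h ; s₁ s₅ → i
  s₂ s₀ → b ; s₂ s₁ → f ; s₂ s₂ → false ; s₂ s₃ → j ; s₂ s₄ → k ; s₂ s₅ → l
  s₃ s₀ → c ; s₃ s₁ → g ; s₃ s₂ → j ; s₃ s₃ → false ; s₃ s₄ → m ; s₃ s₅ → n
  s₄ s₀ → d ; s₄ s₁ → h ; s₄ s₂ → k ; s₄ s₃ → m ; s₄ s₄ → false ; s₄ s₅ → o
  s₅ s₀ → e ; s₅ s₁ → i ; s₅ s₂ → l ; s₅ s₃ → n ; s₅ s₄ → o ; s₅ s₅ → false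

degree : (V → V → Bool) → Vec V k → V → ℕ
degree g v x = tally (λ y → if g x y then 1 else 0) v

-- An isomorphism invariant that leaves only 484 of the 2¹⁵ labelled graphs on six vertices
-- with descending keys.
key : (V → V → Bool) → Vec V k → V → ℕ
key g v x = 100 ℕ.* degree g v x ℕ.+ tally (λ y → if g x y then degree g v y ^ 2 else 0) v

nonneg? : ℤ → Bool
nonneg? (+ _)    = true
nonneg? -[1+ _ ] = false

slack : Table (Table ℤ 5) 5 → Table (Table ℤ 5) 5 → Table (Table ℤ 4) 4 → Vec Bool 15 → ℤ
slack E C P b = scale * core b - squares E C P b

passes : Table (Table ℤ 5) 5 → Table (Table ℤ 5) 5 → Table (Table ℤ 4) 4 → Vec Six 6 → Vec Bool 15 → Bool
passes E C P vs b =
  if descending (map (key (graph b) vs) vs)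
  then nonneg? (permSum (slack E C P ∘ bits (graph b)) vs) else true

-- Settled by evaluation. Patterns whose keys do not descend pass at once; for the others `permSum`
-- runs through the 720 orderings.
all-pass : ∀ b → passes edgeTable coEdgeTable pathTable six b ≡ true
all-pass = everyBits-sound 15 (passes edgeTable coEdgeTable pathTable six) refl

-- The inequality 30 t(D, A) + 42 t(M, B) ≥ 1

weight-cong : ∀ {b c} {i j : ℕ} → b ≡ c → i ≡ j → (if b then i else 0) ≡ (if c then j else 0)
weight-cong refl refl = refl

key-cong : {g h : V → V → Bool} → (∀ x y → g x y ≡ h x y) → (v : Vec V k) → key g v ≗ key h v
key-cong g≗h v x = cong₂ (λ d t → 100 ℕ.* d ℕ.+ t) (degree-cong x)
  (tally-cong (λ y → weight-cong (g≗h x y) (cong (_^ 2) (degree-cong y))) v)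
  where
  degree-cong : degree _ v ≗ degree _ v
  degree-cong x = tally-cong (λ y → weight-cong (g≗h x y) refl) v

key-map : (g : V → V → Bool) (f : W → V) (v : Vec W k) → key g (map f v) ∘ f ≗ key (g on f) v
key-map g f v x = cong₂ (λ d t → 100 ℕ.* d ℕ.+ t) (degree-map x)
  (trans (tally-map _ f v) (tally-cong (λ y → weight-cong {g (f x) (f y)} refl (cong (_^ 2) (degree-map y))) v))
  where
  degree-map : degree g (map f v) ∘ f ≗ degree (g on f) v
  degree-map x = tally-map _ f v

key-sort : (g : V → V → Bool) (κ : V → ℕ) (v : Vec V k) → key g (sort κ v) ≗ key g v
key-sort g κ v x = cong₂ (λ d t → 100 ℕ.* d ℕ.+ t) (tally-sort κ _ v)
  (trans (tally-cong (λ y → weight-cong {g x y} refl (cong (_^ 2) (tally-sort κ _ v))) (sort κ v)) (tally-sort κ _ v))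

bits-map : (g : V → V → Bool) (f : W → V) → bits g ∘ map f ≗ bits (g on f)
bits-map g f (_ ∷ _ ∷ _ ∷ _ ∷ _ ∷ _ ∷ []) = refl

nonneg?-sound : ∀ z → nonneg? z ≡ true → 0ℤ ℤ.≤ z
nonneg?-sound (+ _) _ = ℤ.+≤+ ℕ.z≤n

bits-cong : {g h : V → V → Bool} → (∀ x y → g x y ≡ h x y) → bits g ≗ bits h
bits-cong g≗h v = Vec.map-cong (λ p → g≗h (proj₁ p) (proj₂ p)) (pairs v)

permSum-bits-cong : (Φ : Vec Bool 15 → ℤ) {g h : V → V → Bool} → (∀ x y → g x y ≡ h x y) → ∀ v →
  permSum (Φ ∘ bits g) v ≡ permSum (Φ ∘ bits h) v
permSum-bits-cong Φ g≗h = permSum-cong λ v → cong Φ (bits-cong g≗h v)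

permSum-bits-map : (g : V → V → Bool) (f : W → V) (Φ : Vec Bool 15 → ℤ) → ∀ v →
  permSum (Φ ∘ bits g) (map f v) ≡ permSum (Φ ∘ bits (g on f)) v
permSum-bits-map g f Φ v =
  trans (permSum-map f (Φ ∘ bits g) v) (permSum-cong (λ w → cong Φ (bits-map g f w)) v)

if-true : ∀ {c d} → c ≡ true → (if c then d else true) ≡ true → d ≡ true
if-true refl d = d

select : Vec V 6 → Six → V
select (x₀ ∷ x₁ ∷ x₂ ∷ x₃ ∷ x₄ ∷ x₅ ∷ []) = λ where
  s₀ → x₀ ; s₁ → x₁ ; s₂ → x₂ ; s₃ → x₃ ; s₄ → x₄ ; s₅ → x₅

map-select : (w : Vec V 6) → map (select w) six ≡ w
map-select (_ ∷ _ ∷ _ ∷ _ ∷ _ ∷ _ ∷ []) = refl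

-- The tables and the list of the six vertices stay variables: concrete ones would be
-- expanded by conversion checking.
module _ (E C : Table (Table ℤ 5) 5) (P : Table (Table ℤ 4) 4) (vs : Vec Six 6)
         (all-pass : ∀ b → passes E C P vs b ≡ true) (select-vs : ∀ {V : Set} (w : Vec V 6) → map (select w) vs ≡ w)
         (a : V → V → Bool) (a-sym : ∀ x y → a x y ≡ a y x) (a-irr : ∀ x → a x x ≡ false) where

  certifiedSlack : Vec Bool 15 → ℤ
  certifiedSlack = slack E C P

  -- Pulling `a` back along f yields a graph on `Six`, to which the finite check applies. Repeated
  -- vertices are covered: as `a` is irreflexive, they become non-adjacent twins.
  sorted-permSum-map : (f : Six → V) → descending (map (key a (map f vs)) (map f vs)) ≡ true →
    0ℤ ℤ.≤ permSum (certifiedSlack ∘ bits a) (map f vs)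
  sorted-permSum-map f desc = subst (0ℤ ℤ.≤_) (sym permSum-graph) (nonneg?-sound _ (if-true keys-descending (all-pass b)))
    where
    b : Vec Bool 15
    b = bits (a on f) six
    graph-b : ∀ i j → graph b i j ≡ a (f i) (f j)
    graph-b = λ where
      s₀ s₀ → sym (a-irr _) ; s₀ s₁ → refl ; s₀ s₂ → refl ; s₀ s₃ → refl ; s₀ s₄ → refl ; s₀ s₅ → refl
      s₁ s₀ → a-sym _ _ ; s₁ s₁ → sym (a-irr _) ; s₁ s₂ → refl ; s₁ s₃ → refl ; s₁ s₄ → refl ; s₁ s₅ → refl
      s₂ s₀ → a-sym _ _ ; s₂ s₁ → a-sym _ _ ; s₂ s₂ → sym (a-irr _) ; s₂ s₃ → refl ; s₂ s₄ → refl ; s₂ s₅ → refl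
      s₃ s₀ → a-sym _ _ ; s₃ s₁ → a-sym _ _ ; s₃ s₂ → a-sym _ _ ; s₃ s₃ → sym (a-irr _) ; s₃ s₄ → refl ; s₃ s₅ → refl
      s₄ s₀ → a-sym _ _ ; s₄ s₁ → a-sym _ _ ; s₄ s₂ → a-sym _ _ ; s₄ s₃ → a-sym _ _ ; s₄ s₄ → sym (a-irr _) ; s₄ s₅ → refl
      s₅ s₀ → a-sym _ _ ; s₅ s₁ → a-sym _ _ ; s₅ s₂ → a-sym _ _ ; s₅ s₃ → a-sym _ _ ; s₅ s₄ → a-sym _ _ ; s₅ s₅ → sym (a-irr _)
    keys : map (key (graph b) vs) vs ≡ map (key a (map f vs)) (map f vs)
    keys = trans
      (Vec.map-cong (λ i → trans (key-cong graph-b vs i) (sym (key-map a f vs i))) vs)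
      (Vec.map-∘ (key a (map f vs)) f vs)
    keys-descending : descending (map (key (graph b) vs) vs) ≡ true
    keys-descending = trans (cong descending keys) desc
    permSum-graph : permSum (certifiedSlack ∘ bits a) (map f vs) ≡ permSum (certifiedSlack ∘ bits (graph b)) vs
    permSum-graph = trans (permSum-bits-map a f certifiedSlack vs)
      (permSum-bits-cong certifiedSlack {a on f} {graph b} (λ i j → sym (graph-b i j)) vs)

  sorted-permSum : (w : Vec V 6) → T (descending (map (key a w) w)) → 0ℤ ℤ.≤ permSum (certifiedSlack ∘ bits a) w
  sorted-permSum w desc = subst (λ w → 0ℤ ℤ.≤ permSum (certifiedSlack ∘ bits a) w) (select-vs w)
    (sorted-permSum-map (select w) (trans (cong (λ w → descending (map (key a w) w)) (select-vs w)) (Equivalence.to T-≡ desc)))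

  -- Keys are built from tallies, so the keys of the sorted tuple, computed afresh, are those of v,
  -- and they descend. Sorting also leaves the sum over orderings unchanged, so the finite check
  -- reaches every tuple.
  permSum-slack : (v : Vec V 6) → 0ℤ ℤ.≤ permSum (certifiedSlack ∘ bits a) v
  permSum-slack v = subst (0ℤ ℤ.≤_) (permSum-sort κ (certifiedSlack ∘ bits a) v) $
    sorted-permSum (sort κ v) $
    subst (T ∘ descending) (sym (Vec.map-cong (key-sort a κ v) (sort κ v))) (sort-descending κ v)
    where
    κ : V → ℕ
    κ = key a v

-- Nonnegativity of the averaged squares

Nonnegative : Table (Table ℤ k) k → Set
Nonnegative {k} t = ∀ {n} j (p : Vec (Fin n) j → Vec Bool k) →
  0ℤ ℤ.≤ total j λ v → total j λ w → look (look t (p v)) (p w)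

formTable-nonneg : (F : Table (Vec ℤ m) k) (M : Symmetric m) → T (positiveDefinite M) → Nonnegative (formTable F M)
formTable-nonneg F M pd j p = subst (0ℤ ℤ.≤_)
  (total-cong j λ v → total-cong j λ w → sym (look-formTable (p v) (p w)))
  (total-form-nonneg M pd (look F ∘ p))
  where
  look-formTable : ∀ p q → look (look (formTable F M) p) q ≡ form M (look F p) (look F q)
  look-formTable p q = trans (cong (λ t → look t q) (look-tabulate _ p)) (look-tabulate _ q)

addTable-nonneg : (s t : Table (Table ℤ k) k) → Nonnegative s → Nonnegative t → Nonnegative (addTable s t)
addTable-nonneg s t s≥0 t≥0 j p = subst (0ℤ ℤ.≤_)
  (sym (trans (total-cong j λ v → trans (total-cong j λ w → look-addTable (p v) (p w))
         (total-+ j (λ w → look (look s (p v)) (p w)) (λ w → look (look t (p v)) (p w))))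
       (total-+ j (λ v → total j λ w → look (look s (p v)) (p w)) (λ v → total j λ w → look (look t (p v)) (p w)))))
  (ℤ.+-mono-≤ (s≥0 j p) (t≥0 j p))
  where
  look-addTable : ∀ p q → look (look (addTable s t) p) q ≡ look (look s p) q + look (look t p) q
  look-addTable p q = trans (cong (λ t → look t q) (look-tabulate _ p)) (look-tabulate _ q)

module _ (E C : Table (Table ℤ 5) 5) (P : Table (Table ℤ 4) 4)
         (E≥0 : Nonnegative E) (C≥0 : Nonnegative C) (P≥0 : Nonnegative P)
         (vs : Vec Six 6)
         (all-pass : ∀ b → passes E C P vs b ≡ true) (select-vs : ∀ {V : Set} (w : Vec V 6) → map (select w) vs ≡ w)
         (a : Fin n → Fin n → Bool) where

  twoPattern : Fin n → Fin n → Vec (Fin n) 2 → Vec Bool 5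
  twoPattern x y (u ∷ v ∷ []) = a x u ∷ a y u ∷ a x v ∷ a y v ∷ a u v ∷ []

  fourPattern : (x y u v : Fin n) → Vec (Fin n) 1 → Vec Bool 4
  fourPattern x y u v (w ∷ []) = a x w ∷ a y w ∷ a u w ∷ a v w ∷ []

  edge-squares : ∀ e x y → 0ℤ ℤ.≤ total 2 λ p → total 2 λ q →
    look (look (if e then E else C) (twoPattern x y p)) (twoPattern x y q)
  edge-squares true  x y = E≥0 2 (twoPattern x y)
  edge-squares false x y = C≥0 2 (twoPattern x y)

  path-squares : ∀ c x y u v → 0ℤ ℤ.≤ total 1 λ p → total 1 λ q →
    if c then look (look P (fourPattern x y u v p)) (fourPattern x y u v q) else 0ℤ
  path-squares false x y u v = total-nonneg {n = n} 1 λ p → total-nonneg {n = n} 1 λ q → ℤ.≤-refl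
  path-squares true  x y u v = P≥0 1 (fourPattern x y u v)

  total-squares-nonneg : 0ℤ ℤ.≤ total 6 (squares E C P ∘ bits a)
  total-squares-nonneg = sum-nonneg _ λ x → sum-nonneg _ λ y →
    -- For fixed x and y the edge part is a double sum over (u, v) and (w, z). The path part is
    -- nonnegative already for fixed x, y, u, v.
    subst (0ℤ ℤ.≤_) (sym (total-+ 4 (edgePart x y) (pathPart x y))) $
    ℤ.+-mono-≤ (edge-squares (a x y) x y) $ sum-nonneg _ λ u → sum-nonneg _ λ v → path-squares _ x y u v
    where
    edgePart pathPart : Fin n → Fin n → Vec (Fin n) 4 → ℤ
    edgePart x y (u ∷ v ∷ w ∷ z ∷ []) = look
      (look (if a x y then E else C) (twoPattern x y (u ∷ v ∷ []))) (twoPattern x y (w ∷ z ∷ []))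
    pathPart x y (u ∷ v ∷ w ∷ z ∷ []) =
      if a x y ∧ a x v ∧ a y u ∧ not (a x u) ∧ not (a y v) ∧ not (a u v)
      then look (look P (fourPattern x y u v (w ∷ []))) (fourPattern x y u v (z ∷ [])) else 0ℤ

  core-nonneg : (∀ x y → a x y ≡ a y x) → (∀ x → a x x ≡ false) → 0ℤ ℤ.≤ total 6 (core ∘ bits a)
  core-nonneg a-sym a-irr =
    ℤ.*-cancelˡ-≤-pos 0ℤ (total 6 (core ∘ bits a)) scale $ begin
      scale * 0ℤ        ≡⟨ ℤ.*-zeroʳ scale ⟩
      0ℤ                ≤⟨ ℤ.+-mono-≤ slack≥0 total-squares-nonneg ⟩
      S + Q             ≡⟨ total-+ 6 (slack E C P ∘ bits a) (squares E C P ∘ bits a) ⟨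
      total 6 (λ v → slack E C P (bits a v) + squares E C P (bits a v))
        ≡⟨ (total-cong 6 λ v → cancel (scale * core (bits a v)) (squares E C P (bits a v))) ⟩
      total 6 (λ v → scale * core (bits a v)) ≡⟨ total-*ˡ 6 scale (core ∘ bits a) ⟩
      scale * total 6 (core ∘ bits a) ∎
    where
    open ℤ.≤-Reasoning
    S Q : ℤ
    S = total 6 (slack E C P ∘ bits a)
    Q = total 6 (squares E C P ∘ bits a)
    slack≥0 : 0ℤ ℤ.≤ S
    slack≥0 = total-nonneg-by-symmetry 6 (slack E C P ∘ bits a) (permSum-slack E C P vs all-pass select-vs a a-sym a-irr)
    cancel : ∀ s q → (s - q) + q ≡ s
    cancel = solve-∀

total-core-nonneg : (a : Fin n → Fin n → Bool) → (∀ x y → a x y ≡ a y x) → (∀ x → a x x ≡ false) →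
  0ℤ ℤ.≤ total 6 (core ∘ bits a)
total-core-nonneg = core-nonneg edgeTable coEdgeTable pathTable
  (formTable-nonneg edgeFlags edgeMatrix tt)
  (addTable-nonneg (formTable coEdgeEvenFlags coEdgeEvenMatrix) (formTable coEdgeOddFlags coEdgeOddMatrix)
    (formTable-nonneg coEdgeEvenFlags coEdgeEvenMatrix tt) (formTable-nonneg coEdgeOddFlags coEdgeOddMatrix tt))
  (addTable-nonneg (formTable pathEvenFlags pathEvenMatrix) (formTable pathOddFlags pathOddMatrix)
    (formTable-nonneg pathEvenFlags pathEvenMatrix tt) (formTable-nonneg pathOddFlags pathOddMatrix tt))
  six all-pass map-select

-- Homomorphism counts as sums over tuples

listSum : (A → ℤ) → List A → ℤ
listSum ψ []       = 0ℤ
listSum ψ (x ∷ xs) = ψ x + listSum ψ xs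

listSum-++ : (ψ : A → ℤ) (xs ys : List A) → listSum ψ (xs ++ ys) ≡ listSum ψ xs + listSum ψ ys
listSum-++ ψ []       ys = sym (ℤ.+-identityˡ _)
listSum-++ ψ (x ∷ xs) ys = trans (cong (_+_ (ψ x)) (listSum-++ ψ xs ys)) (sym (ℤ.+-assoc (ψ x) _ _))

listSum-concatMap : (ψ : B → ℤ) (h : A → List B) (xs : List A) →
  listSum ψ (concatMap h xs) ≡ listSum (listSum ψ ∘ h) xs
listSum-concatMap ψ h []       = refl
listSum-concatMap ψ h (x ∷ xs) =
  trans (listSum-++ ψ (h x) (concatMap h xs)) (cong (_+_ (listSum ψ (h x))) (listSum-concatMap ψ h xs))

listSum-cong : {φ ψ : A → ℤ} → φ ≗ ψ → listSum φ ≗ listSum ψ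
listSum-cong φ≗ψ []       = refl
listSum-cong φ≗ψ (x ∷ xs) = cong₂ _+_ (φ≗ψ x) (listSum-cong φ≗ψ xs)

listSum-tabulate : (ψ : A → ℤ) (f : Fin n → A) → listSum ψ (List.tabulate f) ≡ sum (ψ ∘ f)
listSum-tabulate {n = zero}  ψ f = refl
listSum-tabulate {n = suc n} ψ f = cong (_+_ (ψ (f zero))) (listSum-tabulate ψ (f ∘ suc))

listSum-extend : (ψ : B → ℤ) (e : Fin n → A → B) (xs : List A) →
  listSum ψ (concatMap (λ f → List.map (λ v → e v f) (allFin n)) xs) ≡ listSum (λ f → sum λ v → ψ (e v f)) xs
listSum-extend ψ e xs = trans (listSum-concatMap ψ _ xs) (listSum-cong (λ f →
  trans (cong (listSum ψ) (List.map-tabulate (λ v → v) (λ v → e v f))) (listSum-tabulate ψ (λ v → e v f))) xs)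

length-filter : (p : A → Bool) (xs : List A) → + length (filter (λ x → T? (p x)) xs) ≡ listSum (indicator ∘ p) xs
length-filter p []       = refl
length-filter p (x ∷ xs) with p x
... | true  = trans (ℤ.pos-+ 1 _) (cong (_+_ 1ℤ) (length-filter p xs))
... | false = trans (length-filter p xs) (sym (ℤ.+-identityˡ _))

-- The order in which `allMaps` enumerates: the head varies fastest, contrary to `total`. For a
-- fixed k, reversing the tuple makes the two sums agree by computation.
nestedSum : ∀ k → (Vec (Fin n) k → ℤ) → ℤ
nestedSum zero    φ = φ []
nestedSum (suc k) φ = nestedSum k λ w → sum λ v → φ (v ∷ w)

listSum-allMaps : ∀ k (φ : Vec (Fin n) k → ℤ) → listSum (λ f → φ (Vec.tabulate f)) (allMaps k n) ≡ nestedSum k φ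
listSum-allMaps     zero    φ = ℤ.+-identityʳ (φ [])
listSum-allMaps {n} (suc k) φ = trans
  (listSum-extend (λ f → φ (Vec.tabulate f)) _ (allMaps k n))
  (listSum-allMaps k (λ w → sum λ v → φ (v ∷ w)))

module _ (a : Fin n → Fin n → Bool) where

  -- A tuple lists the images of the pattern vertices from the last to the first, as in the
  -- nesting of allMaps.
  diamondBits : Vec (Fin n) 4 → Bool
  diamondBits (x ∷ y ∷ u ∷ v ∷ []) = a v u ∧ a v y ∧ a v x ∧ a u y ∧ a u x ∧ true

  mothBits : Vec (Fin n) 6 → Bool
  mothBits (x ∷ y ∷ u ∷ v ∷ w ∷ z ∷ []) =
    a z w ∧ a z v ∧ a w v ∧ a u y ∧ a u x ∧ a y x ∧ a v u ∧ true

  hom-diamond : + hom diamond a ≡ total 4 (indicator ∘ diamondBits)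
  hom-diamond = trans (length-filter (isHom diamond a) (allMaps 4 n))
    (listSum-allMaps 4 λ where (v ∷ u ∷ y ∷ x ∷ []) → indicator (diamondBits (x ∷ y ∷ u ∷ v ∷ [])))

  hom-moth : + hom moth a ≡ total 6 (indicator ∘ mothBits)
  hom-moth = trans (length-filter (isHom moth a) (allMaps 6 n))
    (listSum-allMaps 6 λ where (z ∷ w ∷ v ∷ u ∷ y ∷ x ∷ []) → indicator (mothBits (x ∷ y ∷ u ∷ v ∷ w ∷ z ∷ [])))

-- Tuples with coinciding entries and the loops of the complement

sum-mono : (f g : Fin n → ℤ) → (∀ x → f x ℤ.≤ g x) → sum f ℤ.≤ sum g
sum-mono {zero}  f g f≤g = ℤ.≤-refl
sum-mono {suc n} f g f≤g = ℤ.+-mono-≤ (f≤g zero) (sum-mono (f ∘ suc) (g ∘ suc) (f≤g ∘ suc))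

total-mono : ∀ k {φ ψ : Vec (Fin n) k → ℤ} → (∀ v → φ v ℤ.≤ ψ v) → total k φ ℤ.≤ total k ψ
total-mono zero    φ≤ψ = φ≤ψ []
total-mono (suc k) φ≤ψ = sum-mono _ _ λ x → total-mono k (φ≤ψ ∘ (x ∷_))

sum-const : ∀ n c → sum {n} (λ _ → c) ≡ + n * c
sum-const zero    c = sym (ℤ.*-zeroˡ c)
sum-const (suc n) c = trans (cong (_+_ c) (sum-const n c)) (sym (ℤ.suc-* (+ n) c))

total-const : ∀ n k c → total {n} k (λ _ → c) ≡ + (n ^ k) * c
total-const n zero    c = sym (ℤ.*-identityˡ c)
total-const n (suc k) c = begin
  (sum {n} λ _ → total {n} k (λ _ → c)) ≡⟨ sum-const n _ ⟩
  + n * total {n} k (λ _ → c)           ≡⟨ cong (+ n *_) (total-const n k c) ⟩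
  + n * (+ (n ^ k) * c)                 ≡⟨ ℤ.*-assoc (+ n) (+ (n ^ k)) c ⟨
  + n * + (n ^ k) * c                   ≡⟨ cong (_* c) (ℤ.pos-* n (n ^ k)) ⟨
  + (n ^ suc k) * c                     ∎
  where open ≡-Reasoning

equal : Fin n → Fin n → ℤ
equal x y = indicator ⌊ x ≟ y ⌋

equal-sym : (x y : Fin n) → equal x y ≡ equal y x
equal-sym x y with x ≟ y | y ≟ x
... | yes _   | yes _   = refl
... | no _    | no _    = refl
... | yes x≡y | no y≢x  = ⊥-elim (y≢x (sym x≡y))
... | no x≢y  | yes y≡x = ⊥-elim (x≢y (sym y≡x))

sum-equal : (x : Fin n) → sum (equal x) ≡ 1ℤ
sum-equal {suc n} zero    = cong (_+_ 1ℤ) (trans (sum-const n 0ℤ) (ℤ.*-zeroʳ (+ n)))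
sum-equal {suc n} (suc x) = trans (ℤ.+-identityˡ _) (trans (sum-cong-≗ equal-suc) (sum-equal x))
  where
  equal-suc : ∀ y → equal (suc x) (suc y) ≡ equal x y
  equal-suc y with x ≟ y
  ... | yes _ = refl
  ... | no _  = refl

-- Both sides carry a factor n, which avoids predecessors in the exponent.
total-hit : ∀ {n k} (i : Fin k) (x : Fin n) → + n * total k (λ v → equal x (lookup v i)) ≡ + (n ^ k)
total-hit {n} {suc k} zero    x = begin
  + n * (sum λ y → total k (λ _ → equal x y)) ≡⟨ cong (+ n *_) (sum-cong-≗ λ y → total-const n k (equal x y)) ⟩
  + n * (sum λ y → + (n ^ k) * equal x y)     ≡⟨ cong (+ n *_) (*-distribˡ-sum (+ (n ^ k)) (equal x)) ⟨
  + n * (+ (n ^ k) * sum (equal x))           ≡⟨ cong (λ s → + n * (+ (n ^ k) * s)) (sum-equal x) ⟩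
  + n * (+ (n ^ k) * 1ℤ)                      ≡⟨ cong (+ n *_) (ℤ.*-identityʳ (+ (n ^ k))) ⟩
  + n * + (n ^ k)                             ≡⟨ ℤ.pos-* n (n ^ k) ⟨
  + (n ^ suc k)                               ∎
  where open ≡-Reasoning
total-hit {n} {suc k} (suc i) x = begin
  + n * (sum {n} λ _ → total k (λ v → equal x (lookup v i))) ≡⟨ cong (+ n *_) (sum-const n _) ⟩
  + n * (+ n * total k (λ v → equal x (lookup v i)))         ≡⟨ cong (+ n *_) (total-hit i x) ⟩
  + n * + (n ^ k)                                            ≡⟨ ℤ.pos-* n (n ^ k) ⟨
  + (n ^ suc k)                                              ∎
  where open ≡-Reasoning

total-collision : ∀ {n k} (i j : Fin k) → i ≢ j →
  + n * total {n} k (λ v → equal (lookup v i) (lookup v j)) ≡ + (n ^ k)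
total-collision zero    zero    i≢j = ⊥-elim (i≢j refl)
total-collision {n} {suc k} zero (suc j) _ = begin
  + n * (sum {n} λ x → total k (λ v → equal x (lookup v j))) ≡⟨ *-distribˡ-sum {n} (+ n) (λ x → total k (λ v → equal x (lookup v j))) ⟩
  (sum {n} λ x → + n * total k (λ v → equal x (lookup v j))) ≡⟨ sum-cong-≗ (total-hit {n} j) ⟩
  (sum {n} λ _ → + (n ^ k))                              ≡⟨ sum-const n _ ⟩
  + n * + (n ^ k)                                        ≡⟨ ℤ.pos-* n (n ^ k) ⟨
  + (n ^ suc k)                                          ∎
  where open ≡-Reasoning
total-collision {n} {suc k} (suc i) zero _ = trans
  (cong (+ n *_) (total-cong {n = n} (suc k) λ v → equal-sym (lookup v (suc i)) (lookup v zero)))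
  (total-collision {n} {suc k} zero (suc i) λ ())
total-collision {n} {suc k} (suc i) (suc j) i≢j = begin
  + n * (sum {n} λ _ → total {n} k (λ v → equal (lookup v i) (lookup v j))) ≡⟨ cong (+ n *_) (sum-const n _) ⟩
  + n * (+ n * total {n} k (λ v → equal (lookup v i) (lookup v j)))
    ≡⟨ cong (+ n *_) (total-collision i j (i≢j ∘ cong suc)) ⟩
  + n * + (n ^ k)                                                           ≡⟨ ℤ.pos-* n (n ^ k) ⟨
  + (n ^ suc k)                                                             ∎
  where open ≡-Reasoning

total-collisions : ∀ {n} (ps : List (Fin k × Fin k)) → All (uncurry _≢_) ps →
  + n * total {n} k (λ v → listSum (λ (i , j) → equal (lookup v i) (lookup v j)) ps) ≡ + length ps * + (n ^ k)
total-collisions {k} {n} [] [] =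
  trans (cong (+ n *_) (trans (total-const n k 0ℤ) (ℤ.*-zeroʳ (+ (n ^ k))))) (ℤ.*-zeroʳ (+ n))
total-collisions {k} {n} ((i , j) ∷ ps) (i≢j ∷ distinct) = begin
  + n * total k (λ v → equal (lookup v i) (lookup v j) + rest v)
    ≡⟨ cong (+ n *_) (total-+ k (λ v → equal (lookup v i) (lookup v j)) rest) ⟩
  + n * (total k (λ v → equal (lookup v i) (lookup v j)) + total k rest)
    ≡⟨ ℤ.*-distribˡ-+ (+ n) _ (total k rest) ⟩
  + n * total k (λ v → equal (lookup v i) (lookup v j)) + + n * total k rest
    ≡⟨ cong₂ _+_ (total-collision i j i≢j) (total-collisions ps distinct) ⟩
  + (n ^ k) + + length ps * + (n ^ k)
    ≡⟨ ℤ.suc-* (+ length ps) (+ (n ^ k)) ⟨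
  + suc (length ps) * + (n ^ k) ∎
  where
  open ≡-Reasoning
  rest : Vec (Fin n) k → ℤ
  rest v = listSum (λ (i , j) → equal (lookup v i) (lookup v j)) ps

indicator-nonneg : ∀ b → 0ℤ ℤ.≤ indicator b
indicator-nonneg true  = ℤ.+≤+ ℕ.z≤n
indicator-nonneg false = ℤ.≤-refl

indicator≤1 : ∀ b → indicator b ℤ.≤ 1ℤ
indicator≤1 true  = ℤ.≤-refl
indicator≤1 false = ℤ.+≤+ ℕ.z≤n

listSum-nonneg : (ψ : A → ℤ) → (∀ x → 0ℤ ℤ.≤ ψ x) → ∀ xs → 0ℤ ℤ.≤ listSum ψ xs
listSum-nonneg ψ ψ≥0 []       = ℤ.≤-refl
listSum-nonneg ψ ψ≥0 (x ∷ xs) = ℤ.+-mono-≤ (ψ≥0 x) (listSum-nonneg ψ ψ≥0 xs)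

-- A union bound: if every `f` holds, then either every guarded test holds as well or some `g` fires
-- and is counted in the last sum.
and-guard : (f g : A → Bool) (xs : List A) →
  indicator (and (List.map f xs))
  ℤ.≤ indicator (and (List.map (λ x → f x ∧ not (g x)) xs)) + listSum (indicator ∘ g) xs
and-guard f g []       = ℤ.≤-refl
and-guard f g (x ∷ xs) with f x | g x
... | false | b     = ℤ.+-mono-≤ (ℤ.≤-refl {0ℤ}) (ℤ.+-mono-≤ (indicator-nonneg b)
                        (listSum-nonneg (indicator ∘ g) (indicator-nonneg ∘ g) xs))
... | true  | true  = ℤ.≤-trans (indicator≤1 _) (ℤ.+-mono-≤ (ℤ.≤-refl {0ℤ}) (ℤ.+-mono-≤ (ℤ.≤-refl {1ℤ})
                        (listSum-nonneg (indicator ∘ g) (indicator-nonneg ∘ g) xs)))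
... | true  | false = subst
  (λ s → indicator (and (List.map f xs)) ℤ.≤ indicator (and (List.map (λ x → f x ∧ not (g x)) xs)) + s)
  (sym (ℤ.+-identityˡ (listSum (indicator ∘ g) xs))) (and-guard f g xs)

-- Positions and order follow `mothBits`, so that the conjunction over this list is `mothBits` by
-- computation.
mothEdges : List (Fin 6 × Fin 6)
mothEdges = (# 5 , # 4) ∷ (# 5 , # 3) ∷ (# 4 , # 3) ∷ (# 2 , # 1) ∷ (# 2 , # 0) ∷ (# 1 , # 0) ∷ (# 3 , # 2) ∷ []

moth-coAdj : (G : Graph) → + size G * total 6 (indicator ∘ mothBits (λ x y → not (adj G x y)))
  ℤ.≤ + size G * + hom moth (coAdj G) + + 7 * + (size G ^ 6)
moth-coAdj G = begin
  + s * total 6 (indicator ∘ mothBits (λ x y → not (adj G x y)))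
    ≤⟨ ℤ.*-monoˡ-≤-nonNeg (+ s) (total-mono 6 guarded) ⟩
  + s * total 6 (λ v → indicator (mothBits (coAdj G) v) + collisions v)
    ≡⟨ cong (+ s *_) (total-+ 6 (indicator ∘ mothBits (coAdj G)) collisions) ⟩
  + s * (total 6 (indicator ∘ mothBits (coAdj G)) + total 6 collisions)
    ≡⟨ ℤ.*-distribˡ-+ (+ s) _ (total 6 collisions) ⟩
  + s * total 6 (indicator ∘ mothBits (coAdj G)) + + s * total 6 collisions
    ≡⟨ cong₂ (λ h c → + s * h + c) (sym (hom-moth (coAdj G))) (total-collisions {n = s} mothEdges distinct) ⟩
  + s * + hom moth (coAdj G) + + 7 * + (s ^ 6) ∎
  where
  open ℤ.≤-Reasoning
  s = size G
  collisions : Vec (Fin s) 6 → ℤ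
  collisions v = listSum (λ (i , j) → equal (lookup v i) (lookup v j)) mothEdges
  distinct : All (uncurry _≢_) mothEdges
  distinct = (λ ()) ∷ (λ ()) ∷ (λ ()) ∷ (λ ()) ∷ (λ ()) ∷ (λ ()) ∷ (λ ()) ∷ []
  guarded : ∀ v → indicator (mothBits (λ x y → not (adj G x y)) v)
    ℤ.≤ indicator (mothBits (coAdj G) v) + collisions v
  guarded v@(_ ∷ _ ∷ _ ∷ _ ∷ _ ∷ _ ∷ []) = and-guard
    (λ (i , j) → not (adj G (lookup v i) (lookup v j)))
    (λ (i , j) → ⌊ lookup v i ≟ lookup v j ⌋) mothEdges

-- The diamond occupies four of the six vertices; the two free ones account for the factor
-- `size G ^ 2`.
total-core : (G : Graph) → total 6 (core ∘ bits (adj G)) ≡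
  + 30 * (+ (size G ^ 2) * + hom diamond (adj G))
  + + 42 * total 6 (indicator ∘ mothBits (λ x y → not (adj G x y))) + - + (size G ^ 6)
total-core G = begin
  total 6 (core ∘ bits a) ≡⟨ total-cong 6 split ⟩
  total 6 (λ v → + 30 * D v + + 42 * M v + - 1ℤ)
    ≡⟨ total-+ 6 (λ v → + 30 * D v + + 42 * M v) (λ _ → - 1ℤ) ⟩
  total 6 (λ v → + 30 * D v + + 42 * M v) + total {s} 6 (λ _ → - 1ℤ)
    ≡⟨ cong₂ _+_ (trans (total-+ 6 (λ v → + 30 * D v) (λ v → + 42 * M v))
         (cong₂ _+_ (total-*ˡ 6 (+ 30) D) (total-*ˡ 6 (+ 42) M))) (total-const s 6 (- 1ℤ)) ⟩
  + 30 * total 6 D + + 42 * total 6 M + + (s ^ 6) * - 1ℤ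
    ≡⟨ cong₂ (λ d e → + 30 * d + + 42 * total 6 M + e) total-D (times-neg-one (+ (s ^ 6))) ⟩
  + 30 * (+ (s ^ 2) * + hom diamond a) + + 42 * total 6 M + - + (s ^ 6) ∎
  where
  open ≡-Reasoning
  s = size G
  a = adj G
  D M : Vec (Fin s) 6 → ℤ
  D (x ∷ y ∷ u ∷ v ∷ _) = indicator (diamondBits a (x ∷ y ∷ u ∷ v ∷ []))
  M = indicator ∘ mothBits (λ x y → not (a x y))
  times-neg-one : ∀ z → z * - 1ℤ ≡ - z
  times-neg-one = solve-∀
  split : ∀ v → core (bits a v) ≡ + 30 * D v + + 42 * M v + - 1ℤ
  split (x ∷ y ∷ u ∷ v ∷ w ∷ z ∷ [])
    rewrite Graph.sym G v u | Graph.sym G v y | Graph.sym G v x | Graph.sym G u y | Graph.sym G u x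
          | Graph.sym G z w | Graph.sym G z v | Graph.sym G w v | Graph.sym G y x = refl
  total-D : total 6 D ≡ + (s ^ 2) * + hom diamond a
  total-D = trans (total-cong 4 inner)
    (trans (total-*ˡ 4 (+ (s ^ 2)) (indicator ∘ diamondBits a)) (cong (+ (s ^ 2) *_) (sym (hom-diamond a))))
    where
    inner : ∀ v → total 2 (λ w → D (v Vec.++ w)) ≡ + (s ^ 2) * indicator (diamondBits a v)
    inner v@(_ ∷ _ ∷ _ ∷ _ ∷ []) = total-const s 2 (indicator (diamondBits a v))

lower-bound : (G : Graph) → let s = size G in
  + s * + (s ^ 6) ℤ.≤
  + 30 * (+ s * + (s ^ 2) * + hom diamond (adj G)) + + 42 * (+ s * + hom moth (coAdj G)) + + 294 * + (s ^ 6)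
lower-bound G = begin
  + s * P                                            ≡⟨ ℤ.+-identityˡ (+ s * P) ⟨
  0ℤ + + s * P                                       ≤⟨ ℤ.+-monoˡ-≤ (+ s * P) s*core≥0 ⟩
  + s * (+ 30 * (S * H) + + 42 * X + - P) + + s * P  ≡⟨ expand (+ s) S H X P ⟩
  + 30 * (+ s * S * H) + + 42 * (+ s * X)
    ≤⟨ ℤ.+-monoʳ-≤ (+ 30 * (+ s * S * H)) (ℤ.*-monoˡ-≤-nonNeg (+ 42) (moth-coAdj G)) ⟩
  + 30 * (+ s * S * H) + + 42 * (+ s * Y + + 7 * P)  ≡⟨ collect (+ 30 * (+ s * S * H)) (+ s * Y) P ⟩
  + 30 * (+ s * S * H) + + 42 * (+ s * Y) + + 294 * P ∎
  where
  open ℤ.≤-Reasoning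
  s = size G
  P = + (s ^ 6)
  S = + (s ^ 2)
  H = + hom diamond (adj G)
  X = total 6 (indicator ∘ mothBits (λ x y → not (adj G x y)))
  Y = + hom moth (coAdj G)
  s*core≥0 : 0ℤ ℤ.≤ + s * (+ 30 * (S * H) + + 42 * X + - P)
  s*core≥0 = subst (ℤ._≤ + s * (+ 30 * (S * H) + + 42 * X + - P)) (ℤ.*-zeroʳ (+ s)) $
    ℤ.*-monoˡ-≤-nonNeg (+ s) $
    subst (0ℤ ℤ.≤_) (total-core G) (total-core-nonneg (adj G) (Graph.sym G) (Graph.irr G))
  expand : ∀ s S H X P → s * (+ 30 * (S * H) + + 42 * X + - P) + s * P ≡ + 30 * (s * S * H) + + 42 * (s * X)
  expand = solve-∀
  collect : ∀ A Y P → A + + 42 * (Y + + 7 * P) ≡ A + + 42 * Y + + 294 * P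
  collect = solve-∀

-- The blow-up of K₃ × K₄

sum-↑ : ∀ m (f : Fin (m ℕ.+ n) → ℤ) → sum f ≡ sum (λ i → f (i ↑ˡ n)) + sum (λ j → f (m ↑ʳ j))
sum-↑ zero    f = sym (ℤ.+-identityˡ _)
sum-↑ (suc m) f = trans (cong (_+_ (f zero)) (sum-↑ m (f ∘ suc))) (sym (ℤ.+-assoc (f zero) _ _))

sum-combine : ∀ m (f : Fin (m ℕ.* n) → ℤ) → sum f ≡ sum λ i → sum λ j → f (combine {m} {n} i j)
sum-combine         zero    f = refl
sum-combine {n = n} (suc m) f =
  trans (sum-↑ n f) (cong (_+_ (sum λ j → f (j ↑ˡ (m ℕ.* n)))) (sum-combine m (λ i → f (n ↑ʳ i))))

remainder-combine : ∀ {m n} (i : Fin m) (j : Fin n) → remainder {m} n (combine i j) ≡ j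
remainder-combine i j = cong proj₂ (Fin.remQuot-combine i j)

-- Every residue has m preimages in each coordinate.
total-remainder : ∀ m k (φ : Vec (Fin n) k → ℤ) →
  total k (φ ∘ map (remainder {m} n)) ≡ + (m ^ k) * total k φ
total-remainder m zero    φ = sym (ℤ.*-identityˡ _)
total-remainder {n} m (suc k) φ = begin
  (sum λ x → total k (φ ∘ (remainder {m} n x ∷_) ∘ map (remainder {m} n)))
    ≡⟨ (sum-cong-≗ λ x → total-remainder m k (φ ∘ (remainder {m} n x ∷_))) ⟩
  (sum λ x → + (m ^ k) * g (remainder {m} n x))
    ≡⟨ sum-combine m (λ x → + (m ^ k) * g (remainder {m} n x)) ⟩
  (sum {m} λ i → sum λ j → + (m ^ k) * g (remainder {m} n (combine i j)))
    ≡⟨ (sum-cong-≗ {m} λ i → sum-cong-≗ λ j → cong (λ r → + (m ^ k) * g r) (remainder-combine i j)) ⟩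
  (sum {m} λ _ → sum λ j → + (m ^ k) * g j) ≡⟨ sum-const m _ ⟩
  + m * (sum λ j → + (m ^ k) * g j)         ≡⟨ cong (+ m *_) (*-distribˡ-sum (+ (m ^ k)) g) ⟨
  + m * (+ (m ^ k) * sum g)                 ≡⟨ ℤ.*-assoc (+ m) (+ (m ^ k)) (sum g) ⟨
  + m * + (m ^ k) * sum g                   ≡⟨ cong (_* sum g) (ℤ.pos-* m (m ^ k)) ⟨
  + (m ^ suc k) * sum g                     ∎
  where
  open ≡-Reasoning
  g : Fin n → ℤ
  g x = total k (φ ∘ (x ∷_))

^-distribʳ-* : ∀ k m n → (m ℕ.* n) ^ k ≡ m ^ k ℕ.* n ^ k
^-distribʳ-* zero    m n = refl
^-distribʳ-* (suc k) m n = trans (cong (m ℕ.* n ℕ.*_) (^-distribʳ-* k m n)) (ℕ.[m*n]*[o*p]≡[m*o]*[n*p] m n (m ^ k) (n ^ k))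

module _ {n} (m : ℕ) (b : Fin n → Fin n → Bool) where

  diamonds-on-remainder : ∀ {c} → total 4 (indicator ∘ diamondBits b) ≡ c →
    total 4 (indicator ∘ diamondBits (b on remainder {m} n)) ≡ + (m ^ 4) * c
  diamonds-on-remainder {c} eq = trans (total-cong 4 natural)
    (trans (total-remainder m 4 (indicator ∘ diamondBits b)) (cong (+ (m ^ 4) *_) eq))
    where
    natural : ∀ v → indicator (diamondBits (b on remainder {m} n) v) ≡ indicator (diamondBits b (map (remainder {m} n) v))
    natural (_ ∷ _ ∷ _ ∷ _ ∷ []) = refl

  moths-on-remainder : ∀ {c} → total 6 (indicator ∘ mothBits b) ≡ c →
    total 6 (indicator ∘ mothBits (b on remainder {m} n)) ≡ + (m ^ 6) * c
  moths-on-remainder {c} eq = trans (total-cong 6 natural)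
    (trans (total-remainder m 6 (indicator ∘ mothBits b)) (cong (+ (m ^ 6) *_) eq))
    where
    natural : ∀ v → indicator (mothBits (b on remainder {m} n) v) ≡ indicator (mothBits b (map (remainder {m} n) v))
    natural (_ ∷ _ ∷ _ ∷ _ ∷ _ ∷ _ ∷ []) = refl

module _ (a : Fin n → Fin n → Bool) where

  triangleEdgeBits : Vec (Fin n) 4 → Bool
  triangleEdgeBits (x ∷ y ∷ u ∷ v ∷ []) = a u y ∧ a u x ∧ a y x ∧ a v u ∧ true

  -- If every vertex lies in the same number c of rooted triangles, the far triangle of the moth can
  -- be stripped off. This leaves 12⁴ instead of 12⁶ tuples to evaluate for the complement of K₃ ×
  -- K₄. The rest of the conjunction is abstracted as `R`.
  moths-by-triangles : ∀ c → (∀ v R → (sum λ w → sum λ z → indicator (a z w ∧ a z v ∧ a w v ∧ R)) ≡ c * indicator R) →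
    ∀ {e} → total 4 (indicator ∘ triangleEdgeBits) ≡ e → total 6 (indicator ∘ mothBits a) ≡ c * e
  moths-by-triangles c triangles eq = trans (total-cong 4 pendant)
    (trans (total-*ˡ 4 c (indicator ∘ triangleEdgeBits)) (cong (c *_) eq))
    where
    pendant : ∀ r → total 2 (λ s → indicator (mothBits a (r Vec.++ s))) ≡ c * indicator (triangleEdgeBits r)
    pendant (x ∷ y ∷ u ∷ v ∷ []) = triangles v (a u y ∧ a u x ∧ a y x ∧ a v u ∧ true)

∧-monoˡ-indicator : ∀ b {c d} e → indicator c ℤ.≤ indicator d → indicator ((b ∧ e) ∧ c) ℤ.≤ indicator (b ∧ d)
∧-monoˡ-indicator false e     c≤d = ℤ.≤-refl
∧-monoˡ-indicator true  true  c≤d = c≤d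
∧-monoˡ-indicator true  {d = true}  false c≤d = ℤ.+≤+ ℕ.z≤n
∧-monoˡ-indicator true  {d = false} false c≤d = ℤ.≤-refl

moth-coAdj-≤ : (G : Graph) → + hom moth (coAdj G) ℤ.≤ total 6 (indicator ∘ mothBits (λ x y → not (adj G x y)))
moth-coAdj-≤ G = subst (ℤ._≤ total 6 (indicator ∘ mothBits b)) (sym (hom-moth (coAdj G))) (total-mono 6 forget)
  where
  b : Fin (size G) → Fin (size G) → Bool
  b x y = not (adj G x y)
  forget : ∀ v → indicator (mothBits (coAdj G) v) ℤ.≤ indicator (mothBits b v)
  forget (x ∷ y ∷ u ∷ v ∷ w ∷ z ∷ []) =
    ∧-monoˡ-indicator (b z w) _ $ ∧-monoˡ-indicator (b z v) _ $ ∧-monoˡ-indicator (b w v) _ $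
    ∧-monoˡ-indicator (b u y) _ $ ∧-monoˡ-indicator (b u x) _ $ ∧-monoˡ-indicator (b y x) _ $
    ∧-monoˡ-indicator (b v u) _ $ ℤ.≤-refl

K₃×K₄ : Fin 12 → Fin 12 → Bool
K₃×K₄ x y = not ⌊ quotient {3} 4 x ≟ quotient 4 y ⌋ ∧ not ⌊ remainder {3} 4 x ≟ remainder {3} 4 y ⌋

blowUp : ℕ → Graph
blowUp m = record
  { size = m ℕ.* 12
  ; adj  = K₃×K₄ on remainder {m} 12
  ; sym  = λ x y → K₃×K₄-sym (remainder {m} 12 x) (remainder {m} 12 y)
  ; irr  = λ x → K₃×K₄-irr (remainder {m} 12 x)
  }
  where
  K₃×K₄-sym : ∀ x y → K₃×K₄ x y ≡ K₃×K₄ y x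
  K₃×K₄-sym = from-yes (Fin.all? λ x → Fin.all? λ y → K₃×K₄ x y Bool.≟ K₃×K₄ y x)
  K₃×K₄-irr : ∀ x → K₃×K₄ x x ≡ false
  K₃×K₄-irr = from-yes (Fin.all? λ x → K₃×K₄ x x Bool.≟ false)

-- There are 72 ordered edges with 2 common neighbours each, and 72 · 2² = 288.
diamonds-in-K₃×K₄ : total 4 (indicator ∘ diamondBits K₃×K₄) ≡ + 288
diamonds-in-K₃×K₄ = refl

-- This kernel has loops, as it should: the twins of a blow-up are non-adjacent, so each class
-- becomes a clique in the complement.
co : Fin 12 → Fin 12 → Bool
co x y = not (K₃×K₄ x y)

-- Six vertices, v included, share a coordinate with v. Of the 36 ordered pairs of these, the 12
-- formed by a further vertex of the row of v and a further vertex of its column are adjacent in K₃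
-- × K₄, which leaves 24.
co-triangles : ∀ v R → (sum λ w → sum λ z → indicator (co z w ∧ co z v ∧ co w v ∧ R)) ≡ + 24 * indicator R
co-triangles v true  = from-yes (Fin.all? λ v →
  (sum λ w → sum λ z → indicator (co z w ∧ co z v ∧ co w v ∧ true)) ℤ.≟ + 24) v
co-triangles v false = from-yes (Fin.all? λ v →
  (sum λ w → sum λ z → indicator (co z w ∧ co z v ∧ co w v ∧ false)) ℤ.≟ + 0) v

-- 12 vertices, 24 rooted triangles at each, and 6 choices for the end of the pendant edge.
triangleEdges-in-co : total 4 (indicator ∘ triangleEdgeBits co) ≡ + 1728
triangleEdges-in-co = refl

moths-in-co : total 6 (indicator ∘ mothBits co) ≡ + 24 * + 1728
moths-in-co = moths-by-triangles co (+ 24) co-triangles triangleEdges-in-co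

diamonds-in-blowUp : ∀ m → + 72 * + hom diamond (adj (blowUp m)) ℤ.≤ + (size (blowUp m) ^ 4)
diamonds-in-blowUp m = begin
  + 72 * + hom diamond (adj (blowUp m))
    ≡⟨ cong (+ 72 *_) (trans (hom-diamond (adj (blowUp m))) (diamonds-on-remainder m K₃×K₄ diamonds-in-K₃×K₄)) ⟩
  + 72 * (+ (m ^ 4) * + 288)                         ≡⟨ rearrange (+ (m ^ 4)) ⟩
  + (m ^ 4) * + (12 ^ 4)                             ≡⟨ ℤ.pos-* (m ^ 4) (12 ^ 4) ⟨
  + (m ^ 4 ℕ.* 12 ^ 4)                               ≡⟨ cong +_ (^-distribʳ-* 4 m 12) ⟨
  + ((m ℕ.* 12) ^ 4)                                 ∎
  where
  open ℤ.≤-Reasoning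
  rearrange : ∀ M → + 72 * (M * + 288) ≡ M * + 20736
  rearrange = solve-∀

moths-in-co-blowUp : ∀ m → + 72 * + hom moth (coAdj (blowUp m)) ℤ.≤ + (size (blowUp m) ^ 6)
moths-in-co-blowUp m = begin
  + 72 * + hom moth (coAdj (blowUp m))             ≤⟨ ℤ.*-monoˡ-≤-nonNeg (+ 72) (moth-coAdj-≤ (blowUp m)) ⟩
  + 72 * total 6 (indicator ∘ mothBits (co on remainder {m} 12))
    ≡⟨ cong (+ 72 *_) (moths-on-remainder m co moths-in-co) ⟩
  + 72 * (+ (m ^ 6) * (+ 24 * + 1728))             ≡⟨ rearrange (+ (m ^ 6)) ⟩
  + (m ^ 6) * + (12 ^ 6)                           ≡⟨ ℤ.pos-* (m ^ 6) (12 ^ 6) ⟨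
  + (m ^ 6 ℕ.* 12 ^ 6)                             ≡⟨ cong +_ (^-distribʳ-* 6 m 12) ⟨
  + ((m ℕ.* 12) ^ 6)                               ∎
  where
  open ℤ.≤-Reasoning
  rearrange : ∀ M → + 72 * (M * (+ 24 * + 1728)) ≡ M * + 2985984
  rearrange = solve-∀

-- Densities

fromℤ-/1 : ∀ z → (z ℚ./ 1) ≡ fromℤ z
fromℤ-/1 z = ℚ.↥p/↧p≡p (fromℤ z)

fromℤ-+ : ∀ y z → fromℤ (y ℤ.+ z) ≡ fromℤ y ℚ.+ fromℤ z
fromℤ-+ y z = sym (trans (cong (ℚ._/ 1) (cong₂ ℤ._+_ (ℤ.*-identityʳ y) (ℤ.*-identityʳ z))) (fromℤ-/1 (y ℤ.+ z)))

fromℤ-* : ∀ y z → fromℤ (y ℤ.* z) ≡ fromℤ y ℚ.* fromℤ z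
fromℤ-* y z = sym (fromℤ-/1 (y ℤ.* z))

fromℤ-mono : ∀ {y z} → y ℤ.≤ z → fromℤ y ℚ.≤ fromℤ z
fromℤ-mono {y} {z} y≤z = *≤* (subst₂ ℤ._≤_ (sym (ℤ.*-identityʳ y)) (sym (ℤ.*-identityʳ z)) y≤z)

/-*-cancel : ∀ z d .{{_ : ℕ.NonZero d}} → (z ℚ./ d) ℚ.* fromℤ (+ d) ≡ fromℤ z
/-*-cancel z d@(suc d-1) = ℚ.toℚᵘ-injective $ begin
  toℚᵘ ((z ℚ./ d) ℚ.* fromℤ (+ d))       ≈⟨ ℚ.toℚᵘ-homo-* (z ℚ./ d) (fromℤ (+ d)) ⟩
  toℚᵘ (z ℚ./ d) ℚᵘ.* mkℚᵘ (+ d) 0        ≈⟨ ℚᵘ.*-cong (ℚ.toℚᵘ-fromℚᵘ (mkℚᵘ z d-1)) ℚᵘ.≃-refl ⟩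
  mkℚᵘ z d-1 ℚᵘ.* mkℚᵘ (+ d) 0            ≈⟨ *≡* (trans (ℤ.*-identityʳ (z ℤ.* + d)) (cong (λ e → z ℤ.* + e) (sym (ℕ.*-identityʳ d)))) ⟩
  mkℚᵘ z 0                                ∎
  where open ℚᵘ.≃-Reasoning

tDens-*-cancel : ∀ H {n} (a : Fin (suc n) → Fin (suc n) → Bool) →
  tDens H a ℚ.* fromℤ (+ (suc n ^ order H)) ≡ fromℤ (+ hom H a)
tDens-*-cancel H {n} a = /-*-cancel (+ hom H a) (suc n ^ order H) {{ℕ.m^n≢0 (suc n) (order H)}}

fromℤ-positive : ∀ m → .{{ℕ.NonZero m}} → ℚ.Positive (fromℤ (+ m))
fromℤ-positive (suc m) = _

lower-val : (G : Graph) → .{{_ : ℕ.NonZero (size G)}} →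
  (let s = size G in
  + s ℤ.* + (s ^ 6) ℤ.≤
  + 30 ℤ.* (+ s ℤ.* + (s ^ 2) ℤ.* + hom diamond (adj G)) ℤ.+ + 42 ℤ.* (+ s ℤ.* + hom moth (coAdj G)) ℤ.+ + 294 ℤ.* + (s ^ 6)) →
  fromℤ (+ size G) ℚ.≤ fromℤ (+ size G) ℚ.* (fromℤ (+ 36) ℚ.* val diamond moth (+ 5 ℚ./ 6) G) ℚ.+ fromℤ (+ 294)
lower-val G@(record { size = suc m }) bound =
  ℚ.*-cancelʳ-≤-pos P {{fromℤ-positive (s ^ 6) {{ℕ.m^n≢0 s 6}}}} $ begin
    N ℚ.* P ≡⟨ fromℤ-* (+ s) (+ (s ^ 6)) ⟨
    fromℤ (+ s ℤ.* + (s ^ 6)) ≤⟨ fromℤ-mono bound ⟩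
    fromℤ (+ 30 ℤ.* (+ s ℤ.* + (s ^ 2) ℤ.* + hD) ℤ.+ + 42 ℤ.* (+ s ℤ.* + hM) ℤ.+ + 294 ℤ.* + (s ^ 6))
      ≡⟨ push ⟩
    fromℤ (+ 30) ℚ.* (N ℚ.* S ℚ.* fromℤ (+ hD)) ℚ.+ fromℤ (+ 42) ℚ.* (N ℚ.* fromℤ (+ hM)) ℚ.+ fromℤ (+ 294) ℚ.* P
      ≡⟨ cong₂ (λ x y → fromℤ (+ 30) ℚ.* (N ℚ.* S ℚ.* x) ℚ.+ fromℤ (+ 42) ℚ.* (N ℚ.* y) ℚ.+ fromℤ (+ 294) ℚ.* P)
           (sym (tDens-*-cancel diamond (adj G))) (sym (tDens-*-cancel moth (coAdj G))) ⟩
    fromℤ (+ 30) ℚ.* (N ℚ.* S ℚ.* (D ℚ.* F)) ℚ.+ fromℤ (+ 42) ℚ.* (N ℚ.* (M ℚ.* P)) ℚ.+ fromℤ (+ 294) ℚ.* P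
      ≡⟨ regroup N S D F M P ⟩
    fromℤ (+ 30) ℚ.* (N ℚ.* D ℚ.* (S ℚ.* F)) ℚ.+ fromℤ (+ 42) ℚ.* (N ℚ.* (M ℚ.* P)) ℚ.+ fromℤ (+ 294) ℚ.* P
      ≡⟨ cong (λ x → fromℤ (+ 30) ℚ.* (N ℚ.* D ℚ.* x) ℚ.+ fromℤ (+ 42) ℚ.* (N ℚ.* (M ℚ.* P)) ℚ.+ fromℤ (+ 294) ℚ.* P) S*F≡P ⟩
    fromℤ (+ 30) ℚ.* (N ℚ.* D ℚ.* P) ℚ.+ fromℤ (+ 42) ℚ.* (N ℚ.* (M ℚ.* P)) ℚ.+ fromℤ (+ 294) ℚ.* P
      -- Here 36 · 5/6 = 30 and 36 · 7/6 = 42 turn the integer weights into `val` at 5/6.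
      ≡⟨ collect N D M P ⟩
    (N ℚ.* (fromℤ (+ 36) ℚ.* ((+ 5 ℚ./ 6) ℚ.* D ℚ.+ (+ 7 ℚ./ 6) ℚ.* M)) ℚ.+ fromℤ (+ 294)) ℚ.* P ∎
  where
  open ℚ.≤-Reasoning
  open +-*-Solver
  s = suc m
  hD = hom diamond (adj G)
  hM = hom moth (coAdj G)
  N = fromℤ (+ s)
  S = fromℤ (+ (s ^ 2))
  F = fromℤ (+ (s ^ 4))
  P = fromℤ (+ (s ^ 6))
  D = t diamond G
  M = tCo moth G
  S*F≡P : S ℚ.* F ≡ P
  S*F≡P = trans (sym (fromℤ-* (+ (s ^ 2)) (+ (s ^ 4))))
    (cong fromℤ (trans (sym (ℤ.pos-* (s ^ 2) (s ^ 4))) (cong +_ (sym (ℕ.^-distribˡ-+-* s 2 4)))))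
  push : fromℤ (+ 30 ℤ.* (+ s ℤ.* + (s ^ 2) ℤ.* + hD) ℤ.+ + 42 ℤ.* (+ s ℤ.* + hM) ℤ.+ + 294 ℤ.* + (s ^ 6)) ≡ _
  push = trans (fromℤ-+ (+ 30 ℤ.* (+ s ℤ.* + (s ^ 2) ℤ.* + hD) ℤ.+ + 42 ℤ.* (+ s ℤ.* + hM)) (+ 294 ℤ.* + (s ^ 6)))
    (cong₂ ℚ._+_
      (trans (fromℤ-+ (+ 30 ℤ.* (+ s ℤ.* + (s ^ 2) ℤ.* + hD)) (+ 42 ℤ.* (+ s ℤ.* + hM)))
        (cong₂ ℚ._+_
          (trans (fromℤ-* (+ 30) (+ s ℤ.* + (s ^ 2) ℤ.* + hD)) (cong (fromℤ (+ 30) ℚ.*_)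
            (trans (fromℤ-* (+ s ℤ.* + (s ^ 2)) (+ hD)) (cong (ℚ._* fromℤ (+ hD)) (fromℤ-* (+ s) (+ (s ^ 2)))))))
          (trans (fromℤ-* (+ 42) (+ s ℤ.* + hM)) (cong (fromℤ (+ 42) ℚ.*_) (fromℤ-* (+ s) (+ hM))))))
      (fromℤ-* (+ 294) (+ (s ^ 6))))
  regroup : ∀ N S D F M P →
    fromℤ (+ 30) ℚ.* (N ℚ.* S ℚ.* (D ℚ.* F)) ℚ.+ fromℤ (+ 42) ℚ.* (N ℚ.* (M ℚ.* P)) ℚ.+ fromℤ (+ 294) ℚ.* P
    ≡ fromℤ (+ 30) ℚ.* (N ℚ.* D ℚ.* (S ℚ.* F)) ℚ.+ fromℤ (+ 42) ℚ.* (N ℚ.* (M ℚ.* P)) ℚ.+ fromℤ (+ 294) ℚ.* P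
  regroup = solve 6 (λ N S D F M P →
    con (fromℤ (+ 30)) :* (N :* S :* (D :* F)) :+ con (fromℤ (+ 42)) :* (N :* (M :* P)) :+ con (fromℤ (+ 294)) :* P
    := con (fromℤ (+ 30)) :* (N :* D :* (S :* F)) :+ con (fromℤ (+ 42)) :* (N :* (M :* P)) :+ con (fromℤ (+ 294)) :* P) refl
  collect : ∀ N D M P →
    fromℤ (+ 30) ℚ.* (N ℚ.* D ℚ.* P) ℚ.+ fromℤ (+ 42) ℚ.* (N ℚ.* (M ℚ.* P)) ℚ.+ fromℤ (+ 294) ℚ.* P
    ≡ (N ℚ.* (fromℤ (+ 36) ℚ.* ((+ 5 ℚ./ 6) ℚ.* D ℚ.+ (+ 7 ℚ./ 6) ℚ.* M)) ℚ.+ fromℤ (+ 294)) ℚ.* P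
  collect = solve 4 (λ N D M P →
    con (fromℤ (+ 30)) :* (N :* D :* P) :+ con (fromℤ (+ 42)) :* (N :* (M :* P)) :+ con (fromℤ (+ 294)) :* P
    := (N :* (con (fromℤ (+ 36)) :* (con (+ 5 ℚ./ 6) :* D :+ con (+ 7 ℚ./ 6) :* M)) :+ con (fromℤ (+ 294))) :* P) refl

-- A positive ε is at least the reciprocal of its denominator, so 36 n ε ≥ 36 · 9 = 324. The error
-- to be absorbed is 294 = 42 · 7, from 42 moths weighted over 7 edges that may collapse.
error-small : ∀ (ε : ℚ) → 0ℚ ℚ.< ε → ∀ n → 9 ℕ.* ↧ₙ ε ℕ.≤ n → fromℤ (+ 294) ℚ.≤ fromℤ (+ n) ℚ.* (fromℤ (+ 36) ℚ.* ε)
error-small ε 0<ε n big = begin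
  fromℤ (+ 294)                                 ≤⟨ fromℤ-mono (ℤ.+≤+ (ℕ.m≤m+n 294 30)) ⟩
  fromℤ (+ 324)                                 ≤⟨ fromℤ-mono numerator-bound ⟩
  fromℤ (+ 36 ℤ.* (+ 9 ℤ.* ↥ ε))                ≡⟨ trans (fromℤ-* (+ 36) (+ 9 ℤ.* ↥ ε)) (cong (fromℤ (+ 36) ℚ.*_) (fromℤ-* (+ 9) (↥ ε))) ⟩
  fromℤ (+ 36) ℚ.* (fromℤ (+ 9) ℚ.* fromℤ (↥ ε))
    ≡⟨ cong (λ x → fromℤ (+ 36) ℚ.* (fromℤ (+ 9) ℚ.* x)) clear ⟨
  fromℤ (+ 36) ℚ.* (fromℤ (+ 9) ℚ.* (ε ℚ.* fromℤ (+ ↧ₙ ε))) ≡⟨ regroup ε (fromℤ (+ ↧ₙ ε)) ⟩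
  (fromℤ (+ 9) ℚ.* fromℤ (+ ↧ₙ ε)) ℚ.* (fromℤ (+ 36) ℚ.* ε)
    ≡⟨ cong (ℚ._* (fromℤ (+ 36) ℚ.* ε)) (trans (sym (fromℤ-* (+ 9) (+ ↧ₙ ε))) (cong fromℤ (sym (ℤ.pos-* 9 (↧ₙ ε))))) ⟩
  fromℤ (+ (9 ℕ.* ↧ₙ ε)) ℚ.* (fromℤ (+ 36) ℚ.* ε)
    ≤⟨ ℚ.*-monoʳ-≤-nonNeg (fromℤ (+ 36) ℚ.* ε) {{nonNeg}} (fromℤ-mono (ℤ.+≤+ big)) ⟩
  fromℤ (+ n) ℚ.* (fromℤ (+ 36) ℚ.* ε) ∎
  where
  open ℚ.≤-Reasoning
  open +-*-Solver
  instance ε-positive = ℚ.positive 0<ε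
  nonNeg : ℚ.NonNegative (fromℤ (+ 36) ℚ.* ε)
  nonNeg = ℚ.pos⇒nonNeg (fromℤ (+ 36) ℚ.* ε) {{ℚ.pos*pos⇒pos (fromℤ (+ 36)) ε}}
  clear : ε ℚ.* fromℤ (+ ↧ₙ ε) ≡ fromℤ (↥ ε)
  clear = trans (cong (ℚ._* fromℤ (+ ↧ₙ ε)) (sym (ℚ.↥p/↧p≡p ε))) (/-*-cancel (↥ ε) (↧ₙ ε))
  numerator-bound : + 324 ℤ.≤ + 36 ℤ.* (+ 9 ℤ.* ↥ ε)
  numerator-bound = ℤ.*-monoˡ-≤-nonNeg (+ 36) (ℤ.*-monoˡ-≤-nonNeg (+ 9) {+ 1} {↥ ε} (positive-numerator ε))
    where
    positive-numerator : ∀ p → .{{ℚ.Positive p}} → + 1 ℤ.≤ ↥ p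
    positive-numerator (mkℚ (+ suc _) _ _) = ℤ.+≤+ (ℕ.s≤s ℕ.z≤n)
  regroup : ∀ e q → fromℤ (+ 36) ℚ.* (fromℤ (+ 9) ℚ.* (e ℚ.* q)) ≡ (fromℤ (+ 9) ℚ.* q) ℚ.* (fromℤ (+ 36) ℚ.* e)
  regroup = solve 2 (λ e q → con (fromℤ (+ 36)) :* (con (fromℤ (+ 9)) :* (e :* q)) := (con (fromℤ (+ 9)) :* q) :* (con (fromℤ (+ 36)) :* e)) refl

lower-val-ε : ∀ ε → 0ℚ ℚ.< ε → ∀ v n → .{{_ : ℕ.NonZero n}} → 9 ℕ.* ↧ₙ ε ℕ.≤ n →
  fromℤ (+ n) ℚ.≤ fromℤ (+ n) ℚ.* (fromℤ (+ 36) ℚ.* v) ℚ.+ fromℤ (+ 294) → (+ 1 ℚ./ 36) ℚ.- ε ℚ.≤ v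
lower-val-ε ε 0<ε v n big bound =
  ℚ.*-cancelˡ-≤-pos (N ℚ.* fromℤ (+ 36)) {{ℚ.pos*pos⇒pos N {{fromℤ-positive n}} (fromℤ (+ 36))}} $ begin
    N ℚ.* fromℤ (+ 36) ℚ.* ((+ 1 ℚ./ 36) ℚ.- ε)            ≡⟨ expand N ε ⟩
    N ℚ.- N ℚ.* (fromℤ (+ 36) ℚ.* ε)
      ≤⟨ ℚ.+-mono-≤ bound (ℚ.neg-antimono-≤ (error-small ε 0<ε n big)) ⟩
    N ℚ.* (fromℤ (+ 36) ℚ.* v) ℚ.+ fromℤ (+ 294) ℚ.- fromℤ (+ 294) ≡⟨ cancel N v ⟩
    N ℚ.* fromℤ (+ 36) ℚ.* v                                ∎
  where
  open ℚ.≤-Reasoning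
  open +-*-Solver
  N = fromℤ (+ n)
  expand : ∀ N ε → N ℚ.* fromℤ (+ 36) ℚ.* ((+ 1 ℚ./ 36) ℚ.- ε) ≡ N ℚ.- N ℚ.* (fromℤ (+ 36) ℚ.* ε)
  expand = solve 2 (λ N ε → N :* con (fromℤ (+ 36)) :* (con (+ 1 ℚ./ 36) :- ε) := N :- N :* (con (fromℤ (+ 36)) :* ε)) refl
  cancel : ∀ N v → N ℚ.* (fromℤ (+ 36) ℚ.* v) ℚ.+ fromℤ (+ 294) ℚ.- fromℤ (+ 294) ≡ N ℚ.* fromℤ (+ 36) ℚ.* v
  cancel = solve 2 (λ N v → N :* (con (fromℤ (+ 36)) :* v) :+ con (fromℤ (+ 294)) :- con (fromℤ (+ 294)) := N :* con (fromℤ (+ 36)) :* v) refl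

tDens-≤-1/72 : ∀ H {n} (a : Fin n → Fin n → Bool) → .{{ℕ.NonZero n}} →
  + 72 ℤ.* + hom H a ℤ.≤ + (n ^ order H) → tDens H a ℚ.≤ + 1 ℚ./ 72
tDens-≤-1/72 H {n@(suc _)} a bound =
  ℚ.*-cancelʳ-≤-pos P {{fromℤ-positive (n ^ order H) {{ℕ.m^n≢0 n (order H)}}}} $
  ℚ.*-cancelˡ-≤-pos (fromℤ (+ 72)) $ begin
    fromℤ (+ 72) ℚ.* (tDens H a ℚ.* P)   ≡⟨ cong (fromℤ (+ 72) ℚ.*_) (tDens-*-cancel H a) ⟩
    fromℤ (+ 72) ℚ.* fromℤ (+ hom H a)   ≡⟨ fromℤ-* (+ 72) (+ hom H a) ⟨
    fromℤ (+ 72 ℤ.* + hom H a)           ≤⟨ fromℤ-mono bound ⟩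
    P                                    ≡⟨ unit P ⟩
    fromℤ (+ 72) ℚ.* ((+ 1 ℚ./ 72) ℚ.* P) ∎
  where
  open ℚ.≤-Reasoning
  open +-*-Solver
  P = fromℤ (+ (n ^ order H))
  unit : ∀ P → P ≡ fromℤ (+ 72) ℚ.* ((+ 1 ℚ./ 72) ℚ.* P)
  unit = solve 1 (λ P → P := con (fromℤ (+ 72)) :* (con (+ 1 ℚ./ 72) :* P)) refl

val-≤-1/36 : ∀ G λ' → 0ℚ ℚ.≤ λ' → λ' ℚ.≤ + 2 ℚ./ 1 →
  t diamond G ℚ.≤ + 1 ℚ./ 72 → tCo moth G ℚ.≤ + 1 ℚ./ 72 → val diamond moth λ' G ℚ.≤ + 1 ℚ./ 36
val-≤-1/36 G λ' 0≤λ' λ'≤2 D≤ M≤ = begin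
  λ' ℚ.* t diamond G ℚ.+ ((+ 2 ℚ./ 1) ℚ.- λ') ℚ.* tCo moth G
    ≤⟨ ℚ.+-mono-≤ (ℚ.*-monoˡ-≤-nonNeg λ' {{ℚ.nonNegative 0≤λ'}} D≤)
                  (ℚ.*-monoˡ-≤-nonNeg ((+ 2 ℚ./ 1) ℚ.- λ') {{ℚ.nonNegative 0≤2-λ'}} M≤) ⟩
  λ' ℚ.* (+ 1 ℚ./ 72) ℚ.+ ((+ 2 ℚ./ 1) ℚ.- λ') ℚ.* (+ 1 ℚ./ 72) ≡⟨ mix λ' ⟩
  + 1 ℚ./ 36 ∎
  where
  open ℚ.≤-Reasoning
  open +-*-Solver
  0≤2-λ' : 0ℚ ℚ.≤ (+ 2 ℚ./ 1) ℚ.- λ'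
  0≤2-λ' = subst (ℚ._≤ (+ 2 ℚ./ 1) ℚ.- λ') (ℚ.+-inverseʳ λ') (ℚ.+-monoˡ-≤ (ℚ.- λ') λ'≤2)
  mix : ∀ l → l ℚ.* (+ 1 ℚ./ 72) ℚ.+ ((+ 2 ℚ./ 1) ℚ.- l) ℚ.* (+ 1 ℚ./ 72) ≡ + 1 ℚ./ 36
  mix = solve 1 (λ l → l :* con (+ 1 ℚ./ 72) :+ (con (+ 2 ℚ./ 1) :- l) :* con (+ 1 ℚ./ 72) := con (+ 1 ℚ./ 36)) refl

-- The two bounds on the lower limit

liminf-≥ : LiminfGE diamond moth ((+ 5) / 6) ((+ 1) / 36)
liminf-≥ ε 0<ε = 9 ℕ.* ↧ₙ ε , bound
  where
  bound : ∀ G → 9 ℕ.* ↧ₙ ε ℕ.≤ size G → (+ 1) / 36 ℚ.- ε ≤ val diamond moth ((+ 5) / 6) G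
  bound G big = lower-val-ε ε 0<ε (val diamond moth ((+ 5) / 6) G) (size G) {{size≢0}} big
    (lower-val G {{size≢0}} (lower-bound G))
    where
    size≢0 : ℕ.NonZero (size G)
    size≢0 = ℕ.>-nonZero (ℕ.≤-trans (ℕ.m≤m*n 1 (9 ℕ.* ↧ₙ ε) {{ℕ.m*n≢0 9 (↧ₙ ε)}}) (ℕ.≤-trans (ℕ.≤-reflexive (ℕ.*-identityˡ _)) big))

liminf-≤ : ∀ (λ' : ℚ) → 0ℚ ≤ λ' → λ' ≤ (+ 2) / 1 → LiminfLE diamond moth λ' ((+ 1) / 36)
liminf-≤ λ' 0≤λ' λ'≤2 ε 0<ε N = G , ℕ.≤-trans (ℕ.n≤1+n N) (ℕ.m≤m*n (suc N) 12) , bound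
  where
  G : Graph
  -- The successor keeps the graph nonempty for N = 0, as `tDens-≤-1/72` requires.
  G = blowUp (suc N)
  bound : val diamond moth λ' G ≤ (+ 1) / 36 ℚ.+ ε
  bound = begin
    val diamond moth λ' G   ≤⟨ val-≤-1/36 G λ' 0≤λ' λ'≤2
                                 (tDens-≤-1/72 diamond (adj G) (diamonds-in-blowUp (suc N)))
                                 (tDens-≤-1/72 moth (coAdj G) (moths-in-co-blowUp (suc N))) ⟩
    (+ 1) / 36              ≡⟨ ℚ.+-identityʳ ((+ 1) / 36) ⟨
    (+ 1) / 36 ℚ.+ 0ℚ       ≤⟨ ℚ.+-monoʳ-≤ ((+ 1) / 36) (ℚ.<⇒≤ 0<ε) ⟩
    (+ 1) / 36 ℚ.+ ε        ∎
    where open ℚ.≤-Reasoning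

-- The second component bounds `c_λ` by 1/36 for all rational λ in [0,2], and the first shows that
-- 5/6 attains the bound. Since `val` is affine in λ with slope between -1 and 1, `c_λ` is
-- continuous in λ, so the supremum over real λ is 1/36 too.
theorem1p11 : LiminfEq diamond moth ((+ 5) / 6) ((+ 1) / 36)
    × (∀ (λ' : ℚ) → 0ℚ ≤ λ' → λ' ≤ (+ 2) / 1 → LiminfLE diamond moth λ' ((+ 1) / 36))
theorem1p11 =
  (liminf-≥ , liminf-≤ ((+ 5) / 6) (from-yes (0ℚ ℚ.≤? (+ 5) / 6)) (from-yes ((+ 5) / 6 ℚ.≤? (+ 2) / 1)))
  , liminf-≤
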